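{- There is no tournament $T$ having two distinct minimal $\tau$-retentive sets $R_1$ and $R_2$ with $|R_1|=|R_2|=7$.
   Context: A tournament $T$ consists of a finite vertex set $V(T)$ and an asymmetric, complete binary relation $\succ$ on $V(T)$ ($x$ dominates $y$ if $x\succ y$). For $v\in V(T)$ let $N^-_T(v)=\{u\in V(T): u\succ v\}$; for $B\subseteq V(T)$, $T[B]$ is the induced subtournament. The tournament equilibrium set $\tau$ is defined recursively: a nonempty $A\subseteq V(T)$ is $\tau$-retentive if for every $v\in A$ with $N^-_T(v)\neq\emptyset$, $\tau(T[N^-_T(v)])\subseteq A$; $A$ is a minimal $\tau$-retentive set if no $\tau$-retentive set of $T$ is a proper subset of $A$; $\tau(T)$ is the union of all minimal $\tau$-retentive sets of $T$. -}

module Defs where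

open import Data.Bool using (Bool; T)
open import Data.Nat using (ℕ; zero; suc)
open import Data.Fin using (Fin)
open import Data.Fin.Subset using (Subset; _∈_; _∉_; _⊆_; _⊂_; _∩_; ⊤; Nonempty; ∣_∣)
open import Data.Vec using (tabulate)
open import Data.Product using (_×_; ∃)
open import Data.Sum using (_⊎_)
open import Data.Empty using (⊥)
open import Relation.Nullary using (¬_)
open import Relation.Binary.PropositionalEquality using (_≢_)

record Tournament (n : ℕ) : Set where
  field
    beats    : Fin n → Fin n → Bool
    asym     : ∀ x y → T (beats x y) → ¬ T (beats y x)
    complete : ∀ x y → x ≢ y → T (beats x y) ⊎ T (beats y x)

open Tournament public

module _ {n : ℕ} (Tn : Tournament n) where

  inN : Subset n → Fin n → Subset n
  inN B v = B ∩ tabulate (λ u → beats Tn u v)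

  mutual
    -- τ(T[B]) as a predicate on vertices, computed with fuel k
    -- (the fuel is adequate whenever k ≥ ∣ B ∣; see τ below).
    τ' : ℕ → Subset n → Fin n → Set
    τ' zero    B x = ⊥
    τ' (suc k) B x = ∃ λ A → MinRetentive' k B A × x ∈ A

    Retentive' : ℕ → Subset n → Subset n → Set
    Retentive' k B A =
      A ⊆ B × Nonempty A ×
      (∀ v → v ∈ A → Nonempty (inN B v) → ∀ y → τ' k (inN B v) y → y ∈ A)

    MinRetentive' : ℕ → Subset n → Subset n → Set
    MinRetentive' k B A =
      Retentive' k B A × (∀ A' → A' ⊂ A → ¬ Retentive' k B A')

  τ : Subset n → Fin n → Set
  τ B = τ' ∣ B ∣ B

  -- minimal τ-retentive sets of T itself (vertex set ⊤ = Fin n); the inner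
  -- τ calls are on sets of size ≤ n - 1, so fuel n is adequate.
  MinimalRetentive : Subset n → Set
  MinimalRetentive A = MinRetentive' n ⊤ A

{-# OPTIONS --safe #-}
-- Distinct minimal τ-retentive sets are disjoint. It therefore suffices to find, for each minimal
-- τ-retentive set R with 7 elements, a multiset L of elements of R such that every vertex outside R
-- beats fewer than half of L: for two disjoint such sets, each side would
-- then win fewer than half of the comparisons between L₁ and L₂.
--
-- A vertex y outside R that beats x ∈ R lies in N⁻(x), where τ(N⁻(x)) ⊆ R. If a ∈ R is unbeaten in
-- R ∩ N⁻(x), it is unbeaten in N⁻(x), so y does not beat both x and a. If τ(N⁻(x)) is a 3-cycle, y
-- beats at most one of its elements. By minimality each v ∈ R lies in some τ(N⁻(x)) with x ∈ R;
-- hence either R is a 3-cycle of the form x ≻ u ≻ Q ≻ x with ∣ Q ∣ = 5, or all in-degrees in R are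
-- at most 4. In the first case L is assembled from a multiset for Q. In the second case, if every x
-- has an unbeaten in-neighbour, R itself serves as L; otherwise R contains a vertex dominated by a
-- 3-cycle as above, which leaves about 2000 labelled tournaments, for which the multisets are
-- tabulated.
module Submission where

open import Defs
open import Algebra.Properties.CommutativeSemigroup using (interchange; x∙yz≈y∙xz)
open import Data.Bool using (Bool; true; false; not; _∧_; _∨_; T)
open import Data.Bool.ListAction using (all; any)
open import Data.Bool.Properties using (T-≡; T-∧; T-∨)
open import Data.Empty using (⊥; ⊥-elim)
open import Data.Fin using (Fin; zero; suc)
import Data.Fin.Properties as Fin
open import Data.Fin.Subset
  using (Subset; _∈_; _∉_; _⊆_; _∩_; _-_; ⁅_⁆; ∣_∣; Nonempty) renaming (⊤ to full)
open import Data.Fin.Subset.Properties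
  using (_∈?_; _⊆?_; _⊂?_; nonempty?; anySubset?; ⊆-antisym; ∈⊤; ∣⊤∣≡n; x∈⁅x⁆; x∈⁅y⁆⇒x≡y; ∣⁅x⁆∣≡1;
         x∈p∩q⁺; x∈p∩q⁻; p⊆q⇒∣p∣≤∣q∣; p⊂q⇒∣p∣<∣q∣; x∈p∧x≢y⇒x∈p-y; x∈p⇒p-x⊂p; p─q⊆p)
open import Data.List
  using (List; []; _∷_; map; filterᵇ; concatMap; allFin; length; lookup; replicate; _++_)
open import Data.List.Membership.Propositional using (find; lose) renaming (_∈_ to _∈ˡ_)
open import Data.List.Membership.Propositional.Properties
  using (∈-map⁺; ∈-map⁻; ∈-++⁺ˡ; ∈-++⁺ʳ; ∈-++⁻; ∈-lookup; ∈-∃++; ∈-allFin; ∈-filter⁺; ∈-filter⁻)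
open import Data.List.Properties
  using (length-map; length-++; length-filter; length-replicate; filter-++; filter-all; filter-none;
         filter-accept; filter-reject)
open import Data.List.Relation.Binary.Permutation.Propositional
  using (_↭_; refl; prep; swap; trans; ↭-sym; ↭⇒↭ₛ)
import Data.List.Relation.Binary.Permutation.Propositional.Properties as Perm
import Data.List.Relation.Binary.Permutation.Setoid.Properties as SetoidPerm
open import Data.List.Relation.Unary.All using (All; []; _∷_)
import Data.List.Relation.Unary.All as All
import Data.List.Relation.Unary.All.Properties as All
open import Data.List.Relation.Unary.AllPairs using ([]; _∷_)
open import Data.List.Relation.Unary.Any using (here; there; index)
open import Data.List.Relation.Unary.Any.Properties using (any⁺; any⁻; lookup-index)
open import Data.List.Relation.Unary.Unique.Propositional using (Unique)
import Data.List.Relation.Unary.Unique.Propositional.Properties as Unique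
open import Data.Nat using (ℕ; zero; suc; _+_; _*_; _≤_; _<_; z≤n; s≤s; _<ᵇ_; _≤?_)
open import Data.Nat.Induction using (<-wellFounded)
open import Data.Nat.ListAction using (sum)
open import Data.Nat.Properties
  using (≤-refl; ≤-reflexive; ≤-trans; ≤-pred; ≤-<-trans; <-≤-trans; <⇒≱; ≰⇒>; n≮0; n≤0⇒n≡0;
         m≤n⇒m≤1+n; m≤m+n; m≤n+m; suc-injective; <ᵇ⇒<; +-suc; +-identityʳ; +-assoc; +-comm;
         +-mono-≤; +-monoʳ-≤; +-monoʳ-<; +-cancelˡ-≤; +-cancelʳ-≤; +-commutativeSemigroup;
         *-comm; *-distribˡ-+; *-monoʳ-≤; module ≤-Reasoning)
open import Data.Product using (_×_; _,_; proj₁; proj₂; ∃; ∃₂; ∃-syntax)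
open import Data.Sum using (_⊎_; inj₁; inj₂)
open import Data.Unit using (⊤; tt)
open import Data.Vec using (Vec; []; _∷_; here; there)
import Data.Vec as Vec
import Data.Vec.Properties as Vec
open import Function using (_∘_; case_of_; Equivalence)
open import Induction.WellFounded using (Acc; acc)
open import Relation.Binary.PropositionalEquality
  using (_≡_; _≢_; _≗_; refl; sym; cong; cong₂; subst; subst₂; setoid; module ≡-Reasoning)
  renaming (trans to ≡-trans)
open import Relation.Nullary using (¬_; Dec; yes; no; contradiction)
open import Relation.Nullary.Decidable using (_×-dec_; _→-dec_; ¬?; decidable-stable; T?)

open Equivalence using (to; from)

private variable
  m : ℕ
  X : Set

-- Minimal retentive sets

module Equilibrium {n : ℕ} (Tn : Tournament n) where

  infix 4 _≻_

  _≻_ : Fin n → Fin n → Set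
  x ≻ y = T (beats Tn x y)

  ≻-asym : ∀ {x y} → x ≻ y → ¬ y ≻ x
  ≻-asym = asym Tn _ _

  ≻-irrefl : ∀ {x} → ¬ x ≻ x
  ≻-irrefl x≻x = ≻-asym x≻x x≻x

  ≻⇒≢ : ∀ {x y} → x ≻ y → x ≢ y
  ≻⇒≢ x≻x refl = ≻-irrefl x≻x

  ≻-connex : ∀ {x y} → x ≢ y → ¬ x ≻ y → y ≻ x
  ≻-connex x≢y x⊁y with complete Tn _ _ x≢y
  ... | inj₁ x≻y = contradiction x≻y x⊁y
  ... | inj₂ y≻x = y≻x

  private variable
    k : ℕ
    A B R : Subset n
    a b c u v x y z : Fin n

  ∈inN⁺ : u ∈ B → u ≻ v → u ∈ inN Tn B v
  ∈inN⁺ {u} u∈B u≻v = x∈p∩q⁺ (u∈B , Vec.lookup⇒[]= u _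
    (≡-trans (Vec.lookup∘tabulate _ u) (to T-≡ u≻v)))

  ∈inN⁻ : u ∈ inN Tn B v → u ∈ B × u ≻ v
  ∈inN⁻ {u} {B} u∈N with u∈B , u∈N⁻ ← x∈p∩q⁻ B _ u∈N =
    u∈B , from T-≡ (≡-trans (sym (Vec.lookup∘tabulate _ u)) (Vec.[]=⇒lookup u∈N⁻))

  ∣inN∣<∣B∣ : v ∈ B → ∣ inN Tn B v ∣ < ∣ B ∣
  ∣inN∣<∣B∣ v∈B = p⊂q⇒∣p∣<∣q∣
    (proj₁ ∘ ∈inN⁻ , _ , v∈B , ≻-irrefl ∘ proj₂ ∘ ∈inN⁻)

  τ′⊆ : τ' Tn k B y → y ∈ B
  τ′⊆ {suc k} (A , ((A⊆B , _) , _) , y∈A) = A⊆B y∈A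

  mutual
    τ′? : ∀ k B y → Dec (τ' Tn k B y)
    τ′? zero    B y = no λ ()
    τ′? (suc k) B y = anySubset? λ A → minRetentive? k B A ×-dec (y ∈? A)

    retentive? : ∀ k B A → Dec (Retentive' Tn k B A)
    retentive? k B A = (A ⊆? B) ×-dec nonempty? A ×-dec
      Fin.all? λ v → (v ∈? A) →-dec (nonempty? (inN Tn B v) →-dec
      Fin.all? λ y → τ′? k (inN Tn B v) y →-dec (y ∈? A))

    minRetentive? : ∀ k B A → Dec (MinRetentive' Tn k B A)
    minRetentive? k B A with retentive? k B A
    ... | no ¬ret = no (¬ret ∘ proj₁)
    ... | yes ret with anySubset? (λ A′ → (A′ ⊂? A) ×-dec retentive? k B A′)
    ...   | yes (A′ , A′⊂A , ret′) = no λ (_ , min) → min A′ A′⊂A ret′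
    ...   | no ∄A′ = yes (ret , λ A′ A′⊂A ret′ → ∄A′ (A′ , A′⊂A , ret′))

  minimise : ∀ A → Acc _<_ ∣ A ∣ → Retentive' Tn k B A → ∃ λ A′ → MinRetentive' Tn k B A′
  minimise {k} {B} A (acc rec) ret with anySubset? (λ A′ → (A′ ⊂? A) ×-dec retentive? k B A′)
  ... | yes (A′ , A′⊂A , ret′) = minimise A′ (rec (p⊂q⇒∣p∣<∣q∣ A′⊂A)) ret′
  ... | no ∄A′ = A , ret , λ A′ A′⊂A ret′ → ∄A′ (A′ , A′⊂A , ret′)

  -- `B` itself is retentive, since `τ'` of an in-neighbourhood stays inside it; descent from `B`
  -- reaches a minimal retentive set.
  minRetentive-exists : Nonempty B → ∃ λ A → MinRetentive' Tn k B A
  minRetentive-exists {B} {k} ne =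
    minimise B (<-wellFounded _) ((λ x∈B → x∈B) , ne , λ v v∈B _ y → proj₁ ∘ ∈inN⁻ ∘ τ′⊆ {k})

  τ′-nonempty : ∣ B ∣ ≤ k → Nonempty B → ∃ λ y → τ' Tn k B y
  τ′-nonempty {B} {zero} ∣B∣≤0 (x , x∈B) =
    contradiction (<-≤-trans (∣inN∣<∣B∣ x∈B) ∣B∣≤0) n≮0
  τ′-nonempty {B} {suc k} _ ne
    with A , min@((_ , (y , y∈A) , _) , _) ← minRetentive-exists {k = k} ne = y , A , min , y∈A

  -- The bound on ∣ B ∣ makes the fuel k adequate.
  record Guided (R : Subset n) (k : ℕ) (B : Subset n) : Set where
    constructor guided
    field
      fuel : ∣ B ∣ ≤ k
      τ⊆R  : ∀ {y} → τ' Tn k B y → y ∈ R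

  open Guided public

  weaken : A ⊆ R → Guided A k B → Guided R k B
  weaken A⊆R (guided f g) = guided f (A⊆R ∘ g)

  retentive⇒guided : Retentive' Tn k B A → ∣ B ∣ ≤ suc k → v ∈ A → Guided A k (inN Tn B v)
  retentive⇒guided {k} (A⊆B , _ , ret) f v∈A = guided
    (≤-pred (≤-trans (∣inN∣<∣B∣ (A⊆B v∈A)) f))
    λ {y} t → ret _ v∈A (y , τ′⊆ {k} t) y t

  -- A nonempty `B` has a nonempty τ, and `Guided` places it in `R`: any vertex of `B` forces a
  -- vertex of `R` into `B`.
  guided-occupied : Guided R k B → x ∈ B → ∃ λ y → τ' Tn k B y × y ∈ R × y ∈ B
  guided-occupied {k = k} (guided f g) x∈B with y , t ← τ′-nonempty f (_ , x∈B) = y , t , g t , τ′⊆ {k} t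

  min⊆ : Guided R (suc k) B → MinRetentive' Tn k B A → A ⊆ R
  min⊆ (guided _ g) min y∈A = g (_ , min , y∈A)

  -- A minimal retentive set of `B` through `v` lies in `R`. This allows the same arguments to be
  -- repeated inside an in-neighbourhood.
  τ⇒guided : Guided R k B → τ' Tn k B v → ∃ λ k′ → Guided R k′ (inN Tn B v)
  τ⇒guided {k = suc k} G@(guided f _) (A , min@(ret , _) , v∈A) =
    k , weaken (min⊆ G min) (retentive⇒guided ret f v∈A)

  mutual
    -- Induction on the fuel. A member `v` of `A` other than `a` loses to `a`, so `a` lies in the
    -- in-neighbourhood of `v` and is unbeaten there by `A`, the new guiding set; hence `a` belongs
    -- to its τ, which is contained in `A`.
    top∈min : Guided R (suc k) B → a ∈ B → (∀ {z} → z ∈ B → z ∈ R → ¬ z ≻ a) →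
              MinRetentive' Tn k B A → a ∈ A
    top∈min {a = a} G@(guided f _) a∈B top min@(ret@(A⊆B , (v , v∈A) , _) , _) with v Fin.≟ a
    ... | yes refl = v∈A
    ... | no v≢a =
      τ⊆R G′ (proj₁ (top-unbeaten G′ (∈inN⁺ a∈B a≻v) λ z∈N z∈A → top (proj₁ (∈inN⁻ z∈N)) (A⊆R z∈A)))
      where
      A⊆R = min⊆ G min
      G′ = retentive⇒guided ret f v∈A
      a≻v = ≻-connex v≢a (top (A⊆B v∈A) (A⊆R v∈A))

    -- A vertex of `B` beating `a` would make the in-neighbourhood of `a` nonempty, and
    -- `guided-occupied` would then provide a vertex of `R` that beats `a`.
    top-unbeaten : Guided R k B → a ∈ B → (∀ {z} → z ∈ B → z ∈ R → ¬ z ≻ a) →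
                   τ' Tn k B a × (∀ {z} → z ∈ B → ¬ z ≻ a)
    top-unbeaten {k = zero} (guided f _) a∈B _ = contradiction (<-≤-trans (∣inN∣<∣B∣ a∈B) f) n≮0
    top-unbeaten {k = suc k} {a = a} G@(guided f _) a∈B top
      with A , min@(ret , _) ← minRetentive-exists {k = k} (_ , a∈B) =
      (A , min , a∈A) , λ z∈B z≻a →
        let y , _ , y∈A , y∈N = guided-occupied (retentive⇒guided ret f a∈A) (∈inN⁺ z∈B z≻a)
            y∈B , y≻a = ∈inN⁻ y∈N
        in top y∈B (min⊆ G min y∈A) y≻a
      where a∈A = top∈min G a∈B top min

  -- As `a` is unbeaten in `B`, its singleton is vacuously retentive; every minimal retentive set
  -- contains `a`, so none is larger.
  top-unique : Guided R k B → a ∈ B → (∀ {z} → z ∈ B → z ∈ R → ¬ z ≻ a) → τ' Tn k B y → y ≡ a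
  top-unique {k = suc k} {a = a} {y = y} G a∈B top (A , min@(_ , minimal) , y∈A) with y Fin.≟ a
  ... | yes y≡a = y≡a
  ... | no y≢a = contradiction ret (minimal ⁅ a ⁆
    ((λ v∈a → subst (_∈ A) (sym (x∈⁅y⁆⇒x≡y a v∈a)) (top∈min G a∈B top min)) ,
     y , y∈A , y≢a ∘ x∈⁅y⁆⇒x≡y a))
    where
    ret : Retentive' Tn k _ ⁅ a ⁆
    ret = (λ v∈a → subst (_∈ _) (sym (x∈⁅y⁆⇒x≡y a v∈a)) a∈B) , (a , x∈⁅x⁆ a) ,
      λ v v∈a (z , z∈N) → let z∈B , z≻v = ∈inN⁻ z∈N in
        contradiction (subst (z ≻_) (x∈⁅y⁆⇒x≡y a v∈a) z≻v) (proj₂ (top-unbeaten G a∈B top) z∈B)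

  -- The last three fields make each vertex of the cycle unbeaten by `P` among the in-neighbours of
  -- its successor, which is the situation of `top-unbeaten`.
  record Cycle (P : Fin n → Set) (a b c : Fin n) : Set where
    field
      a≻b : a ≻ b
      b≻c : b ≻ c
      c≻a : c ≻ a
      ab  : ∀ {z} → P z → z ≻ b → ¬ z ≻ a
      bc  : ∀ {z} → P z → z ≻ c → ¬ z ≻ b
      ca  : ∀ {z} → P z → z ≻ a → ¬ z ≻ c

  rotate : ∀ {P} → Cycle P a b c → Cycle P b c a
  rotate C = record { a≻b = b≻c ; b≻c = c≻a ; c≻a = a≻b ; ab = bc ; bc = ca ; ca = ab }
    where open Cycle C

  private
    Outside : (a b c : Fin n) → Fin n → Set
    Outside a b c z = z ≢ a × z ≢ b × z ≢ c

  module _ (G : Guided R (suc k) B) (min : MinRetentive' Tn k B A) where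

    -- `top-unbeaten` applies to the in-neighbourhood of `b` with `A` as guiding set. Iteration
    -- carries membership in `A` backwards round the cycle.
    min-step : Cycle (λ z → z ∈ B × z ∈ R) a b c → a ∈ B → b ∈ A →
               a ∈ A × (∀ {z} → z ∈ B → z ≻ b → ¬ z ≻ a)
    min-step C a∈B b∈A =
      let t , unbeaten = top-unbeaten Gb (∈inN⁺ a∈B a≻b)
                           λ z∈N z∈A → let z∈B , z≻b = ∈inN⁻ z∈N in ab (z∈B , min⊆ G min z∈A) z≻b
      in τ⊆R Gb t , λ z∈B z≻b → unbeaten (∈inN⁺ z∈B z≻b)
      where
      open Cycle C
      Gb = retentive⇒guided (proj₁ min) (fuel G) b∈A

    -- A vertex `z` of `A` does not beat both `a` and `b`, so it has an in-neighbour in `B`;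
    -- retentiveness of `A` then yields one in `A`.
    climb : Cycle (λ z → z ∈ B × z ∈ R) a b c → a ∈ B → b ∈ B → z ∈ A →
            Outside a b c z → ∃ λ w → w ∈ A × w ≻ z
    climb {a = a} {z = z} C a∈B b∈B z∈A (z≢a , z≢b , _) =
      let w , _ , w∈A , w∈N = guided-occupied Gz (proj₂ ne) in w , w∈A , proj₂ (∈inN⁻ w∈N)
      where
      open Cycle C
      Gz = retentive⇒guided (proj₁ min) (fuel G) z∈A
      ne : Nonempty (inN Tn B z)
      ne with complete Tn _ _ z≢b
      ... | inj₂ b≻z = _ , ∈inN⁺ b∈B b≻z
      ... | inj₁ z≻b = _ , ∈inN⁺ a∈B
        (≻-connex z≢a (ab (proj₁ (proj₁ min) z∈A , min⊆ G min z∈A) z≻b))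

  -- At most two climbs inside a minimal retentive set `A` lead to the cycle, because the last
  -- hypothesis excludes a chain `v ≻ w ≻ z` off the cycle. Then `min-step` brings `b` into `A`, and
  -- one more use of it gives the claim.
  cycle-unbeaten : Guided R k B → a ∈ B → b ∈ B → c ∈ B →
    Cycle (λ z → z ∈ B × z ∈ R) a b c →
    (∀ {z w v} → z ∈ B → z ∈ R → Outside a b c z → w ∈ B → w ∈ R → Outside a b c w →
       v ∈ B → v ∈ R → Outside a b c v → w ≻ z → ¬ v ≻ w) →
    ∀ {y} → y ∈ B → y ≻ b → ¬ y ≻ a
  cycle-unbeaten {k = zero} (guided f _) a∈B = contradiction (<-≤-trans (∣inN∣<∣B∣ a∈B) f) n≮0
  cycle-unbeaten {k = suc k} {B = B} {a = a} {b = b} {c = c} G a∈B b∈B c∈B C shallow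
    with A , min@((A⊆B , (z , z∈A) , _) , _) ← minRetentive-exists {k = k} (_ , a∈B) =
    proj₂ (min-step G min C a∈B b∈A)
    where
    A⊆R = min⊆ G min
    C′ = rotate C
    C″ = rotate C′

    meets : ∀ {z} → z ∈ A → b ∈ A ⊎ Outside a b c z
    meets {z} z∈A with z Fin.≟ a | z Fin.≟ b | z Fin.≟ c
    ... | _ | yes refl | _ = inj₁ z∈A
    ... | _ | _ | yes refl = inj₁ (proj₁ (min-step G min C′ b∈B z∈A))
    ... | yes refl | _ | _ =
      inj₁ (proj₁ (min-step G min C′ b∈B (proj₁ (min-step G min C″ c∈B z∈A))))
    ... | no z≢a | no z≢b | no z≢c = inj₂ (z≢a , z≢b , z≢c)

    b∈A : b ∈ A
    b∈A with meets z∈A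
    ... | inj₁ b∈A = b∈A
    ... | inj₂ oz with w , w∈A , w≻z ← climb G min C a∈B b∈B z∈A oz with meets w∈A
    ...   | inj₁ b∈A = b∈A
    ...   | inj₂ ow with v , v∈A , v≻w ← climb G min C a∈B b∈B w∈A ow with meets v∈A
    ...     | inj₁ b∈A = b∈A
    ...     | inj₂ ov = contradiction v≻w
      (shallow (A⊆B z∈A) (A⊆R z∈A) oz (A⊆B w∈A) (A⊆R w∈A) ow (A⊆B v∈A) (A⊆R v∈A) ov w≻z)

  -- Otherwise deleting x from a minimal retentive set containing it would leave a retentive set.
  harmless-unbeaten : Guided R k B → τ' Tn k B x → (∀ {v} → v ∈ B → v ∈ R → ¬ x ≻ v) →
                      ∀ {z} → z ∈ B → ¬ z ≻ x
  harmless-unbeaten {k = suc k} {B} {x} G@(guided f _) (A , min@(ret@(A⊆B , _ , τ⊆A) , minimal) , x∈A)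
                    harmless z∈B z≻x
    with y , _ , y∈A , y∈N ← guided-occupied (retentive⇒guided ret f x∈A) (∈inN⁺ z∈B z≻x) =
    minimal (A - x) (x∈p⇒p-x⊂p x∈A)
      ( A⊆B ∘ p─q⊆p A ⁅ x ⁆
      , (y , x∈p∧x≢y⇒x∈p-y y∈A (≻⇒≢ (proj₂ (∈inN⁻ y∈N))))
      , λ v v∈A-x ne y t → let v∈A = p─q⊆p A ⁅ x ⁆ v∈A-x in
          x∈p∧x≢y⇒x∈p-y (τ⊆A v v∈A ne y t) λ where
            refl → harmless (A⊆B v∈A) (min⊆ G min v∈A) (proj₂ (∈inN⁻ (τ′⊆ {k} t))))

-- Finite computation

Relᵇ : ℕ → Set
Relᵇ m = Fin m → Fin m → Bool

_≡ᵇ_ : Fin m → Fin m → Bool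
zero  ≡ᵇ zero  = true
zero  ≡ᵇ suc j = false
suc i ≡ᵇ zero  = false
suc i ≡ᵇ suc j = i ≡ᵇ j

isTop : Relᵇ m → List (Fin m) → Fin m → Bool
isTop _≻_ S a = all (λ z → not (z ≻ a)) S

beatsBoth : Relᵇ m → List (Fin m) → Fin m → Fin m → Bool
beatsBoth _≻_ S u v = any (λ z → (z ≻ u) ∧ (z ≻ v)) S

shallow : Relᵇ m → List (Fin m) → Bool
shallow _≻_ S = all (λ z → all (λ w → not (w ≻ z) ∨ all (λ v → not (v ≻ w)) S) S) S

-- Presupposes a ≻ b. By shallowness, a minimal retentive set inside S meets the cycle.
isCycle : Relᵇ m → List (Fin m) → Fin m → Fin m → Fin m → Bool
isCycle _≻_ S a b c = (b ≻ c) ∧ (c ≻ a) ∧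
  not (beatsBoth _≻_ S b a) ∧ not (beatsBoth _≻_ S c b) ∧ not (beatsBoth _≻_ S a c) ∧
  shallow _≻_ (filterᵇ (λ z → not ((z ≡ᵇ a) ∨ (z ≡ᵇ b) ∨ (z ≡ᵇ c))) S)

onlyIf : {A : Set} → Bool → List A → List A
onlyIf true  xs = xs
onlyIf false xs = []

orElse : {A : Set} → List A → List A → List A
orElse []       ys = ys
orElse (x ∷ xs) _  = x ∷ xs

-- Pairs come from `top-unbeaten`, triples from `cycle-unbeaten`: nothing beats `x` together with
-- both ends of an arc of the cycle. Rotations of a cycle are enumerated as well, so all three arcs
-- occur.
pairs triples : Relᵇ m → Fin m → List (Fin m) → List (List (Fin m))
pairs   _≻_ x S = map (λ a → x ∷ a ∷ []) (filterᵇ (isTop _≻_ S) S)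
triples _≻_ x S = concatMap (λ a → concatMap (λ b → onlyIf (a ≻ b) (concatMap (λ c →
  onlyIf (isCycle _≻_ S a b c) ((x ∷ a ∷ b ∷ []) ∷ [])) S)) S) S

-- An empty list means that `x` is unbeaten in `R`. A vertex beating `x` would force a vertex of `R`
-- to beat it too, so `x` alone is an edge.
edgesAt : Relᵇ m → Fin m → List (Fin m) → List (List (Fin m))
edgesAt _≻_ x []        = (x ∷ []) ∷ []
edgesAt _≻_ x S@(_ ∷ _) = orElse (pairs _≻_ x S) (triples _≻_ x S)

-- For labels of R, no vertex outside R beats all members of an edge.
edges : Relᵇ m → List (List (Fin m))
edges {m} _≻_ = concatMap (λ x → edgesAt _≻_ x (filterᵇ (_≻ x) (allFin m))) (allFin m)

vecs : ∀ m → List (Vec Bool m)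
vecs zero    = [] ∷ []
vecs (suc m) = map (true ∷_) (vecs m) ++ map (false ∷_) (vecs m)

-- Label sets containing no edge: the candidates for what a vertex outside `R` can beat.
independents : List (List (Fin m)) → List (Vec Bool m)
independents {m} es = filterᵇ (λ U → all (λ e → not (all (Vec.lookup U) e)) es) (vecs m)

light : List (Fin m) → Vec Bool m → Bool
light L U = (2 * length (filterᵇ (Vec.lookup U) L)) <ᵇ length L

someLight : List (List (Fin m)) → List (Vec Bool m) → Bool
someLight Ls Us = any (λ L → all (light L) Us) Ls

balanced : List (List (Fin m)) → Relᵇ m → Bool
balanced Ls _≻_ = someLight Ls (independents (edges _≻_))

multiset : Vec ℕ m → List (Fin m)
multiset []      = []
multiset (k ∷ w) = replicate k zero ++ map suc (multiset w)

-- Codes the strict upper triangle of the relation, so that every value describes a tournament and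
-- exhaustive checks run over independent bits.
Arcs : ℕ → Set
Arcs zero    = ⊤
Arcs (suc m) = Vec Bool m × Arcs m

arc : Arcs m → Relᵇ m
arc {suc m} (r , t) zero    zero    = false
arc {suc m} (r , t) zero    (suc j) = Vec.lookup r j
arc {suc m} (r , t) (suc i) zero    = not (Vec.lookup r i)
arc {suc m} (r , t) (suc i) (suc j) = arc t i j

∀ᵇ : (Bool → Bool) → Bool
∀ᵇ P = P false ∧ P true

∀ᵛ : ∀ m → (Vec Bool m → Bool) → Bool
∀ᵛ zero    P = P []
∀ᵛ (suc m) P = ∀ᵇ λ b → ∀ᵛ m λ v → P (b ∷ v)

∀ᵗ : ∀ m → (Arcs m → Bool) → Bool
∀ᵗ zero    P = P tt
∀ᵗ (suc m) P = ∀ᵗ m λ t → ∀ᵛ m λ r → P (r , t)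

dichotomous : Relᵇ m → Bool
dichotomous {m} _≻_ = any (isTop _≻_ V) V ∨
  any (λ a → any (λ b → (a ≻ b) ∧ any (isCycle _≻_ V a b) V) V) V
  where V = allFin m

-- Four vertices suffice: where this is applied to the in-neighbours of `x` in `R`, at least two of
-- the six other vertices lose to `x`.
small-dichotomous : ∀ᵗ 1 (λ t → dichotomous (arc t)) ∧ ∀ᵗ 2 (λ t → dichotomous (arc t)) ∧
                    ∀ᵗ 3 (λ t → dichotomous (arc t)) ∧ ∀ᵗ 4 (λ t → dichotomous (arc t)) ≡ true
small-dichotomous = refl

rotations₅ : Vec ℕ 5 → List (Vec ℕ 5)
rotations₅ (a ∷ b ∷ c ∷ d ∷ e ∷ []) =
  (a ∷ b ∷ c ∷ d ∷ e ∷ []) ∷ (b ∷ c ∷ d ∷ e ∷ a ∷ []) ∷ (c ∷ d ∷ e ∷ a ∷ b ∷ []) ∷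
  (d ∷ e ∷ a ∷ b ∷ c ∷ []) ∷ (e ∷ a ∷ b ∷ c ∷ d ∷ []) ∷ []

-- The tabulated weights were found by a computer search; a vector lists the multiplicities of the
-- labels.
weights₅ : List (Vec ℕ 5)
weights₅ = concatMap rotations₅ (
  (1 ∷ 0 ∷ 0 ∷ 0 ∷ 0 ∷ []) ∷ (1 ∷ 1 ∷ 1 ∷ 0 ∷ 0 ∷ []) ∷
  (1 ∷ 1 ∷ 0 ∷ 1 ∷ 0 ∷ []) ∷ (1 ∷ 1 ∷ 1 ∷ 1 ∷ 1 ∷ []) ∷
  (2 ∷ 0 ∷ 1 ∷ 1 ∷ 1 ∷ []) ∷ (2 ∷ 1 ∷ 0 ∷ 1 ∷ 1 ∷ []) ∷
  [])

allBalanced₅ : List (List (Fin 5)) → Bool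
allBalanced₅ Ls = ∀ᵗ 5 λ t → balanced Ls (arc t)

-- An evaluation over the 1024 labelled tournaments with five vertices.
balanced₅ : allBalanced₅ (map multiset weights₅) ≡ true
balanced₅ = refl

-- Rotating the cycle `a ≻ b ≻ c ≻ a` maps the admissible `anchored` family to itself, so one table
-- entry serves three labellings.
rotations₇ : Vec ℕ 7 → List (Vec ℕ 7)
rotations₇ (o₃ ∷ o₂ ∷ o₁ ∷ x ∷ a ∷ b ∷ c ∷ []) =
  (o₃ ∷ o₂ ∷ o₁ ∷ x ∷ a ∷ b ∷ c ∷ []) ∷
  (o₃ ∷ o₂ ∷ o₁ ∷ x ∷ b ∷ c ∷ a ∷ []) ∷
  (o₃ ∷ o₂ ∷ o₁ ∷ x ∷ c ∷ a ∷ b ∷ []) ∷ []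

weights₇ : List (Vec ℕ 7)
weights₇ = concatMap rotations₇ (
  (0 ∷ 0 ∷ 0 ∷ 0 ∷ 1 ∷ 1 ∷ 1 ∷ []) ∷ (2 ∷ 0 ∷ 0 ∷ 2 ∷ 1 ∷ 1 ∷ 1 ∷ []) ∷
  (0 ∷ 1 ∷ 1 ∷ 1 ∷ 2 ∷ 2 ∷ 2 ∷ []) ∷ (1 ∷ 1 ∷ 1 ∷ 0 ∷ 2 ∷ 2 ∷ 2 ∷ []) ∷
  (0 ∷ 0 ∷ 2 ∷ 2 ∷ 1 ∷ 1 ∷ 1 ∷ []) ∷ (0 ∷ 2 ∷ 1 ∷ 1 ∷ 1 ∷ 1 ∷ 1 ∷ []) ∷
  (1 ∷ 2 ∷ 0 ∷ 0 ∷ 2 ∷ 1 ∷ 1 ∷ []) ∷ (0 ∷ 0 ∷ 1 ∷ 1 ∷ 2 ∷ 2 ∷ 1 ∷ []) ∷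
  (1 ∷ 0 ∷ 0 ∷ 0 ∷ 2 ∷ 1 ∷ 1 ∷ []) ∷ (0 ∷ 2 ∷ 1 ∷ 1 ∷ 2 ∷ 1 ∷ 0 ∷ []) ∷
  (0 ∷ 1 ∷ 0 ∷ 0 ∷ 2 ∷ 1 ∷ 1 ∷ []) ∷ (2 ∷ 1 ∷ 0 ∷ 1 ∷ 2 ∷ 1 ∷ 0 ∷ []) ∷
  (2 ∷ 0 ∷ 2 ∷ 1 ∷ 2 ∷ 1 ∷ 1 ∷ []) ∷ (2 ∷ 1 ∷ 2 ∷ 1 ∷ 2 ∷ 2 ∷ 1 ∷ []) ∷
  (0 ∷ 2 ∷ 0 ∷ 2 ∷ 1 ∷ 1 ∷ 1 ∷ []) ∷ (2 ∷ 2 ∷ 2 ∷ 2 ∷ 1 ∷ 1 ∷ 1 ∷ []) ∷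
  (1 ∷ 1 ∷ 2 ∷ 2 ∷ 1 ∷ 1 ∷ 1 ∷ []) ∷ (1 ∷ 2 ∷ 1 ∷ 1 ∷ 2 ∷ 2 ∷ 2 ∷ []) ∷
  (1 ∷ 2 ∷ 1 ∷ 2 ∷ 1 ∷ 1 ∷ 1 ∷ []) ∷ (2 ∷ 1 ∷ 1 ∷ 2 ∷ 1 ∷ 1 ∷ 1 ∷ []) ∷
  (1 ∷ 0 ∷ 0 ∷ 1 ∷ 2 ∷ 2 ∷ 1 ∷ []) ∷ (1 ∷ 2 ∷ 1 ∷ 0 ∷ 2 ∷ 0 ∷ 1 ∷ []) ∷
  (2 ∷ 1 ∷ 1 ∷ 0 ∷ 1 ∷ 1 ∷ 1 ∷ []) ∷ (1 ∷ 1 ∷ 1 ∷ 0 ∷ 2 ∷ 1 ∷ 1 ∷ []) ∷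
  (1 ∷ 1 ∷ 2 ∷ 1 ∷ 2 ∷ 1 ∷ 1 ∷ []) ∷ (1 ∷ 1 ∷ 1 ∷ 1 ∷ 1 ∷ 1 ∷ 1 ∷ []) ∷
  (0 ∷ 1 ∷ 0 ∷ 0 ∷ 1 ∷ 1 ∷ 0 ∷ []) ∷ (0 ∷ 1 ∷ 1 ∷ 0 ∷ 2 ∷ 0 ∷ 1 ∷ []) ∷
  (0 ∷ 2 ∷ 1 ∷ 0 ∷ 1 ∷ 1 ∷ 0 ∷ []) ∷ (1 ∷ 0 ∷ 1 ∷ 0 ∷ 2 ∷ 1 ∷ 0 ∷ []) ∷
  (0 ∷ 1 ∷ 2 ∷ 0 ∷ 2 ∷ 1 ∷ 1 ∷ []) ∷ (1 ∷ 1 ∷ 1 ∷ 2 ∷ 1 ∷ 1 ∷ 0 ∷ []) ∷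
  [])

-- Labels o₃, o₂, o₁, x, a, b, c with a ≻ b ≻ c ≻ a all beating x, which beats o₂ and o₃, and o₂ ≻ o₃.
anchored : Bool → Vec Bool 3 → Bool → Vec Bool 3 → Bool → Vec Bool 3 → Arcs 7
anchored o₁≻x o₁ o₂≻o₁ o₂ o₃≻o₁ o₃ =
  (false ∷ o₃≻o₁ ∷ false ∷ o₃) , (o₂≻o₁ ∷ false ∷ o₂) , (o₁≻x ∷ o₁) ,
  (false ∷ false ∷ false ∷ []) , (true ∷ false ∷ []) , (true ∷ []) , [] , tt

-- If `o₁` loses to `x`, the three out-neighbours are labelled along a chain `o₁ ≻ o₂ ≻ o₃`.
-- Otherwise `o₁` is a fourth in-neighbour of `x`, and beats at most one vertex of the cycle.
admissible : Bool → Vec Bool 3 → Bool → Bool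
admissible false _                  o₂≻o₁ = not o₂≻o₁
admissible true  (a ∷ b ∷ c ∷ []) _     = not (b ∧ a) ∧ not (c ∧ b) ∧ not (a ∧ c)

allBalanced₇ : List (List (Fin 7)) → Bool
allBalanced₇ Ls =
  ∀ᵇ λ o₁≻x → ∀ᵛ 3 λ o₁ → ∀ᵇ λ o₂≻o₁ → not (admissible o₁≻x o₁ o₂≻o₁) ∨
  (∀ᵛ 3 λ o₂ → ∀ᵇ λ o₃≻o₁ → ∀ᵛ 3 λ o₃ → balanced Ls (arc (anchored o₁≻x o₁ o₂≻o₁ o₂ o₃≻o₁ o₃)))

-- Each value of `o₁≻x` has 8 admissible continuations, and the remaining entries 128 values: 2048
-- tournaments in all.
balanced₇ : allBalanced₇ (map multiset weights₇) ≡ true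
balanced₇ = refl

-- Soundness of the computation

T-not⁻ : ∀ {b} → T (not b) → ¬ T b
T-not⁻ {false} _ ()

T-not⁺ : ∀ {b} → ¬ T b → T (not b)
T-not⁺ {false} _  = tt
T-not⁺ {true}  ¬b = ⊥-elim (¬b tt)

T-implies⁻ : ∀ {a b} → T (not a ∨ b) → T a → T b
T-implies⁻ {true} t _ = t

∈-filterᵇ⁻ : ∀ (p : X → Bool) {v xs} → v ∈ˡ filterᵇ p xs → v ∈ˡ xs × T (p v)
∈-filterᵇ⁻ p = ∈-filter⁻ (T? ∘ p)

∈-filterᵇ⁺ : ∀ (p : X → Bool) {v xs} → v ∈ˡ xs → T (p v) → v ∈ˡ filterᵇ p xs
∈-filterᵇ⁺ p = ∈-filter⁺ (T? ∘ p)

All-onlyIf : ∀ {P : X → Set} b {xs} → (T b → All P xs) → All P (onlyIf b xs)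
All-onlyIf true  h = h tt
All-onlyIf false h = []

All-orElse : ∀ {P : X → Set} {xs ys} → All P xs → All P ys → All P (orElse xs ys)
All-orElse []       qs = qs
All-orElse (p ∷ ps) _  = p ∷ ps

All-concatMap : ∀ {Y : Set} {P : Y → Set} (f : X → List Y) {xs} →
                (∀ {x} → x ∈ˡ xs → All P (f x)) → All P (concatMap f xs)
All-concatMap f h = All.concat⁺ (All.map⁺ (All.tabulate h))

all-lookup : ∀ (p : X → Bool) {xs v} → T (all p xs) → v ∈ˡ xs → T (p v)
all-lookup p {xs} t = All.lookup (All.all⁺ p xs t)

any-witness : ∀ (p : X → Bool) xs → T (any p xs) → ∃ λ x → x ∈ˡ xs × T (p x)
any-witness p xs = find ∘ any⁻ p xs

≡ᵇ⇒≡ : ∀ (i j : Fin m) → T (i ≡ᵇ j) → i ≡ j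
≡ᵇ⇒≡ zero    zero    _ = refl
≡ᵇ⇒≡ (suc i) (suc j) t = cong suc (≡ᵇ⇒≡ i j t)

record CycleIn (_≻_ : Relᵇ m) (S : List (Fin m)) (a b c : Fin m) : Set where
  field
    b≻c : T (b ≻ c)
    c≻a : T (c ≻ a)
    ab  : ∀ {z} → z ∈ˡ S → T (z ≻ b) → ¬ T (z ≻ a)
    bc  : ∀ {z} → z ∈ˡ S → T (z ≻ c) → ¬ T (z ≻ b)
    ca  : ∀ {z} → z ∈ˡ S → T (z ≻ a) → ¬ T (z ≻ c)
    low : ∀ {z w v} → z ∈ˡ S → (z ≢ a × z ≢ b × z ≢ c) → w ∈ˡ S → (w ≢ a × w ≢ b × w ≢ c) →
          v ∈ˡ S → (v ≢ a × v ≢ b × v ≢ c) → T (w ≻ z) → ¬ T (v ≻ w)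

isCycle-sound : ∀ (_≻_ : Relᵇ m) S {a b c} → T (isCycle _≻_ S a b c) → CycleIn _≻_ S a b c
isCycle-sound _≻_ S {a} {b} {c} t =
  let b≻c , t = to (T-∧ {b ≻ c}) t
      c≻a , t = to (T-∧ {c ≻ a}) t
      ab , t = to (T-∧ {not (beatsBoth _≻_ S b a)}) t
      bc , t = to (T-∧ {not (beatsBoth _≻_ S c b)}) t
      ca , t = to (T-∧ {not (beatsBoth _≻_ S a c)}) t
  in record
  { b≻c = b≻c ; c≻a = c≻a ; ab = ¬both ab ; bc = ¬both bc ; ca = ¬both ca
  ; low = λ z∈S oz w∈S ow v∈S ov w≻z v≻w →
      T-not⁻ (all-lookup _
        (T-implies⁻ (all-lookup _ (all-lookup _ t (keep z∈S oz)) (keep w∈S ow)) w≻z) (keep v∈S ov)) v≻w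
  }
  where
  ¬both : ∀ {u v} → T (not (beatsBoth _≻_ S u v)) → ∀ {z} → z ∈ˡ S → T (z ≻ u) → ¬ T (z ≻ v)
  ¬both t z∈S z≻u z≻v = T-not⁻ t (any⁺ _ (lose z∈S (from T-∧ (z≻u , z≻v))))
  keep : ∀ {z} → z ∈ˡ S → z ≢ a × z ≢ b × z ≢ c → z ∈ˡ filterᵇ _ S
  keep {z} z∈S (z≢a , z≢b , z≢c) = ∈-filterᵇ⁺ _ z∈S (T-not⁺ λ t → case to T-∨ t of λ where
    (inj₁ z≡a) → z≢a (≡ᵇ⇒≡ z a z≡a)
    (inj₂ t) → case to T-∨ t of λ where
      (inj₁ z≡b) → z≢b (≡ᵇ⇒≡ z b z≡b)
      (inj₂ z≡c) → z≢c (≡ᵇ⇒≡ z c z≡c))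

All-triples : ∀ {P : List (Fin m) → Set} (_≻_ : Relᵇ m) x S →
  (∀ {a b c} → a ∈ˡ S → b ∈ˡ S → c ∈ˡ S → T (a ≻ b) → CycleIn _≻_ S a b c → P (x ∷ a ∷ b ∷ [])) →
  All P (triples _≻_ x S)
All-triples _≻_ x S h =
  All-concatMap _ λ {a} a∈S → All-concatMap _ λ {b} b∈S → All-onlyIf (a ≻ b) λ a≻b →
  All-concatMap _ λ {c} c∈S → All-onlyIf (isCycle _≻_ S a b c) λ t →
  h a∈S b∈S c∈S a≻b (isCycle-sound _≻_ S t) ∷ []

∈-vecs : ∀ (U : Vec Bool m) → U ∈ˡ vecs m
∈-vecs []          = here refl
∈-vecs (true  ∷ U) = ∈-++⁺ˡ (∈-map⁺ (true ∷_) (∈-vecs U))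
∈-vecs (false ∷ U) = ∈-++⁺ʳ _ (∈-map⁺ (false ∷_) (∈-vecs U))

length-filterᵇ-map : ∀ {Y : Set} (p : Y → Bool) (q : X → Bool) (f : X → Y) → q ≗ p ∘ f → ∀ xs →
  length (filterᵇ q xs) ≡ length (filterᵇ p (map f xs))
length-filterᵇ-map p q f q≗p∘f [] = refl
length-filterᵇ-map p q f q≗p∘f (x ∷ xs) with q x | p (f x) | q≗p∘f x
... | true  | _ | refl = cong suc (length-filterᵇ-map p q f q≗p∘f xs)
... | false | _ | refl = length-filterᵇ-map p q f q≗p∘f xs

∀ᵇ-sound : ∀ P → T (∀ᵇ P) → ∀ b → T (P b)
∀ᵇ-sound P t false = proj₁ (to T-∧ t)
∀ᵇ-sound P t true  = proj₂ (to T-∧ t)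

∀ᵛ-sound : ∀ P → T (∀ᵛ m P) → ∀ v → T (P v)
∀ᵛ-sound P t []      = t
∀ᵛ-sound P t (b ∷ v) = ∀ᵛ-sound (λ v → P (b ∷ v)) (∀ᵇ-sound (λ b → ∀ᵛ _ λ v → P (b ∷ v)) t b) v

∀ᵗ-sound : ∀ P → T (∀ᵗ m P) → ∀ t → T (P t)
∀ᵗ-sound {zero}  P p tt      = p
∀ᵗ-sound {suc m} P p (r , t) = ∀ᵛ-sound _ (∀ᵗ-sound {m} _ p t) r

-- Transfer of the computed weights from labels to vertices

module Charts {n : ℕ} (Tn : Tournament n) where
  open Equilibrium Tn

  count : Fin n → List (Fin n) → ℕ
  count y L = length (filterᵇ (beats Tn y) L)

  -- The ambient set `B` is `full` for the final multisets, and an in-neighbourhood `N x` when a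
  -- five-vertex set `Q` is weighted.
  record Balanced (R B : Subset n) (L : List (Fin n)) : Set where
    field
      inside : All (λ v → v ∈ B × v ∈ R) L
      halved : ∀ {y} → y ∈ B → y ∉ R → 2 * count y L < length L

  open Balanced public

  -- A labelling of the part of `R` in `B`. The field `nbhds` is what makes the edges sound: τ of
  -- each in-neighbourhood lies in `R`.
  record Chart (R B : Subset n) (_≻ₘ_ : Relᵇ m) (r : Fin m → Fin n) : Set where
    field
      arcs   : ∀ i j → (i ≻ₘ j) ≡ beats Tn (r i) (r j)
      range  : ∀ i → r i ∈ B × r i ∈ R
      covers : ∀ {v} → v ∈ B → v ∈ R → ∃ λ i → r i ≡ v
      nbhds  : ∀ i → ∃ λ k → Guided R k (inN Tn B (r i))

  module _ {R B : Subset n} {_≻ₘ_ : Relᵇ m} {r : Fin m → Fin n} (C : Chart R B _≻ₘ_ r) where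
    open Chart C

    ≻ₘ⁺ : ∀ {i j} → r i ≻ r j → T (i ≻ₘ j)
    ≻ₘ⁺ = subst T (sym (arcs _ _))

    ≻ₘ⁻ : ∀ {i j} → T (i ≻ₘ j) → r i ≻ r j
    ≻ₘ⁻ = subst T (arcs _ _)

    module _ {x : Fin m} {S : List (Fin m)}
             (S⁺ : ∀ {j} → T (j ≻ₘ x) → j ∈ˡ S) (S⁻ : ∀ {j} → j ∈ˡ S → T (j ≻ₘ x))
             {y : Fin n} (y∈B : y ∈ B) (y≻x : y ≻ r x) where

      private
        N = inN Tn B (r x)
        G = proj₂ (nbhds x)

        label : ∀ {z} → z ∈ N → z ∈ R → ∃ λ j → r j ≡ z × j ∈ˡ S
        label z∈N z∈R with z∈B , z≻x ← ∈inN⁻ z∈N with j , refl ← covers z∈B z∈R = j , refl , S⁺ (≻ₘ⁺ z≻x)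

        ∈N : ∀ {j} → j ∈ˡ S → r j ∈ N
        ∈N j∈S = ∈inN⁺ (proj₁ (range _)) (≻ₘ⁻ (S⁻ j∈S))

      S-occupied : ∃ λ j → j ∈ˡ S
      S-occupied with w , _ , w∈R , w∈N ← guided-occupied G (∈inN⁺ y∈B y≻x)
                 with j , _ , j∈S ← label w∈N w∈R = j , j∈S

      top-sound : ∀ {a} → a ∈ˡ S → T (isTop _≻ₘ_ S a) → ¬ y ≻ r a
      top-sound {a} a∈S top = proj₂ (top-unbeaten G (∈N a∈S) unbeaten) (∈inN⁺ y∈B y≻x)
        where
        unbeaten : ∀ {z} → z ∈ N → z ∈ R → ¬ z ≻ r a
        unbeaten z∈N z∈R z≻a with j , refl , j∈S ← label z∈N z∈R = T-not⁻ (all-lookup _ top j∈S) (≻ₘ⁺ z≻a)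

      cycle-sound : ∀ {a b c} → a ∈ˡ S → b ∈ˡ S → c ∈ˡ S → T (a ≻ₘ b) → CycleIn _≻ₘ_ S a b c →
                    y ≻ r b → ¬ y ≻ r a
      cycle-sound {a} {b} {c} a∈S b∈S c∈S a≻b cyc = cycle-unbeaten G (∈N a∈S) (∈N b∈S) (∈N c∈S)
        (record { a≻b = ≻ₘ⁻ a≻b ; b≻c = ≻ₘ⁻ b≻c ; c≻a = ≻ₘ⁻ c≻a ; ab = lift ab ; bc = lift bc ; ca = lift ca })
        low′ (∈inN⁺ y∈B y≻x)
        where
        open CycleIn cyc
        lift : ∀ {u v} → (∀ {z} → z ∈ˡ S → T (z ≻ₘ u) → ¬ T (z ≻ₘ v)) →
               ∀ {z} → z ∈ N × z ∈ R → z ≻ r u → ¬ z ≻ r v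
        lift f (z∈N , z∈R) z≻u z≻v with j , refl , j∈S ← label z∈N z∈R = f j∈S (≻ₘ⁺ z≻u) (≻ₘ⁺ z≻v)
        Outside′ : Fin n → Set
        Outside′ z = z ≢ r a × z ≢ r b × z ≢ r c
        unlabel : ∀ {j} → Outside′ (r j) → j ≢ a × j ≢ b × j ≢ c
        unlabel (p , q , s) = p ∘ cong r , q ∘ cong r , s ∘ cong r
        low′ : ∀ {z w v} → z ∈ N → z ∈ R → Outside′ z → w ∈ N → w ∈ R → Outside′ w →
               v ∈ N → v ∈ R → Outside′ v → w ≻ z → ¬ v ≻ w
        low′ z∈N z∈R oz w∈N w∈R ow v∈N v∈R ov w≻z v≻w
          with _ , refl , i∈S ← label z∈N z∈R
          with _ , refl , j∈S ← label w∈N w∈R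
          with _ , refl , k∈S ← label v∈N v∈R =
          low i∈S (unlabel oz) j∈S (unlabel ow) k∈S (unlabel ov) (≻ₘ⁺ w≻z) (≻ₘ⁺ v≻w)

    edgesAt-sound : ∀ {x} S → (∀ {j} → T (j ≻ₘ x) → j ∈ˡ S) → (∀ {j} → j ∈ˡ S → T (j ≻ₘ x)) →
      ∀ {y} → y ∈ B → All (λ e → ¬ All (λ i → y ≻ r i) e) (edgesAt _≻ₘ_ x S)
    edgesAt-sound [] S⁺ S⁻ y∈B = (λ { (y≻x ∷ []) → case proj₂ (S-occupied S⁺ S⁻ y∈B y≻x) of λ () }) ∷ []
    edgesAt-sound {x} S@(_ ∷ _) S⁺ S⁻ y∈B = All-orElse
      (All.map⁺ (All.tabulate λ a∈ → let a∈S , top = ∈-filterᵇ⁻ (isTop _≻ₘ_ S) {xs = S} a∈ in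
        λ { (y≻x ∷ y≻a ∷ []) → top-sound S⁺ S⁻ y∈B y≻x a∈S top y≻a }))
      (All-triples _≻ₘ_ x S λ { a∈S b∈S c∈S a≻b cyc (y≻x ∷ y≻a ∷ y≻b ∷ []) →
        cycle-sound S⁺ S⁻ y∈B y≻x a∈S b∈S c∈S a≻b cyc y≻b y≻a })

    edges-sound : ∀ {y} → y ∈ B → All (λ e → ¬ All (λ i → y ≻ r i) e) (edges _≻ₘ_)
    edges-sound y∈B = All-concatMap _ {allFin m} λ {x} _ →
      edgesAt-sound (filterᵇ (_≻ₘ x) (allFin m)) (∈-filterᵇ⁺ (_≻ₘ x) (∈-allFin _))
        (proj₂ ∘ ∈-filterᵇ⁻ (_≻ₘ x) {xs = allFin m}) y∈B

    -- By `edges-sound` the labels beaten by a given `y` contain no edge, so they form one of the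
    -- sets `U` against which `L` was tested.
    balanced-sound : ∀ Ls → T (balanced Ls _≻ₘ_) → ∃ (Balanced R B)
    balanced-sound Ls t with L , _ , t ← any-witness _ Ls t = map r L , record
      { inside = All.map⁺ (All.universal range L)
      ; halved = λ {y} y∈B _ →
          let U = Vec.tabulate (λ i → beats Tn y (r i))
              U≗ = Vec.lookup∘tabulate (λ i → beats Tn y (r i))
              independent : T (all (λ e → not (all (Vec.lookup U) e)) (edges _≻ₘ_))
              independent = All.all⁻ _ (All.map (λ {e} ¬y≻e → T-not⁺ λ U⊇e →
                ¬y≻e (All.map (λ {i} → subst T (U≗ i)) (All.all⁺ (Vec.lookup U) e U⊇e))) (edges-sound y∈B))
          in subst (λ c → 2 * c < _) (length-filterᵇ-map (beats Tn y) (Vec.lookup U) r U≗ L)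
               (subst (2 * length (filterᵇ (Vec.lookup U) L) <_) (sym (length-map r L))
                 (<ᵇ⇒< _ _ (all-lookup (light L) t (∈-filterᵇ⁺ _ (∈-vecs U) independent))))
      }

-- Listings of the vertices of a set

¬T⇒false : ∀ {b} → ¬ T b → b ≡ false
¬T⇒false {false} _  = refl
¬T⇒false {true}  ¬b = ⊥-elim (¬b tt)

Unique-resp-↭ : ∀ {xs ys : List X} → xs ↭ ys → Unique xs → Unique ys
Unique-resp-↭ = SetoidPerm.Unique-resp-↭ (setoid _) ∘ ↭⇒↭ₛ

extract : ∀ {v : X} {xs} → v ∈ˡ xs → ∃ λ ys → xs ↭ v ∷ ys
extract v∈xs with ys , zs , refl ← ∈-∃++ v∈xs = ys ++ zs , Perm.shift _ ys zs

extract-≢ : ∀ {u v : X} {xs ys} → u ∈ˡ xs → xs ↭ v ∷ ys → u ≢ v → u ∈ˡ ys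
extract-≢ u∈xs p u≢v with Perm.∈-resp-↭ p u∈xs
... | here u≡v   = contradiction u≡v u≢v
... | there u∈ys = u∈ys

splitBy : ∀ (p : X → Bool) xs → ∃₂ λ ins outs → xs ↭ ins ++ outs × All (T ∘ p) ins × All (¬_ ∘ T ∘ p) outs
splitBy p [] = [] , [] , refl , [] , []
splitBy p (x ∷ xs) with ins , outs , π , is , os ← splitBy p xs with T? (p x)
... | yes px = x ∷ ins , outs , prep x π , px ∷ is , os
... | no ¬px = ins , x ∷ outs , trans (prep x π) (↭-sym (Perm.shift x ins outs)) , is , ¬px ∷ os

length-filter-mono : ∀ (p : X → Bool) {xs ys} → Unique xs → (∀ {v} → v ∈ˡ xs → v ∈ˡ ys) →
                     length (filterᵇ p xs) ≤ length (filterᵇ p ys)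
length-filter-mono p {xs = []} _ _ = z≤n
length-filter-mono p {xs = x ∷ xs} (x∉xs ∷ u) xs⊆ys with zs , π ← extract (xs⊆ys (here refl)) =
  ≤-trans (head (length-filter-mono p u λ v∈xs →
             extract-≢ (xs⊆ys (there v∈xs)) π (λ v≡x → All.lookup x∉xs v∈xs (sym v≡x))))
          (≤-reflexive (sym (Perm.↭-length (Perm.filter-↭ (T? ∘ p) π))))
  where
  head : ∀ {zs} → length (filterᵇ p xs) ≤ length (filterᵇ p zs) →
         length (filterᵇ p (x ∷ xs)) ≤ length (filterᵇ p (x ∷ zs))
  head le with p x
  ... | true  = s≤s le
  ... | false = le

elements : Subset m → List (Fin m)
elements []          = []
elements (true  ∷ p) = zero ∷ map suc (elements p)
elements (false ∷ p) = map suc (elements p)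

∈-elements⁺ : ∀ {p : Subset m} {v} → v ∈ p → v ∈ˡ elements p
∈-elements⁺ here = here refl
∈-elements⁺ (there {y = true}  v∈p) = there (∈-map⁺ suc (∈-elements⁺ v∈p))
∈-elements⁺ (there {y = false} v∈p) = ∈-map⁺ suc (∈-elements⁺ v∈p)

∈-elements⁻ : ∀ (p : Subset m) {v} → v ∈ˡ elements p → v ∈ p
∈-elements⁻ (true  ∷ p) (here refl) = here
∈-elements⁻ (true  ∷ p) (there v∈) with _ , w∈ , refl ← ∈-map⁻ suc v∈ = there (∈-elements⁻ p w∈)
∈-elements⁻ (false ∷ p) v∈ with _ , w∈ , refl ← ∈-map⁻ suc v∈ = there (∈-elements⁻ p w∈)

elements-unique : ∀ (p : Subset m) → Unique (elements p)
elements-unique []          = []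
elements-unique (true  ∷ p) =
  All.map⁺ (All.universal (λ _ ()) _) ∷ Unique.map⁺ Fin.suc-injective (elements-unique p)
elements-unique (false ∷ p) = Unique.map⁺ Fin.suc-injective (elements-unique p)

length-elements : ∀ (p : Subset m) → length (elements p) ≡ ∣ p ∣
length-elements []          = refl
length-elements (true  ∷ p) = cong suc (≡-trans (length-map suc (elements p)) (length-elements p))
length-elements (false ∷ p) = ≡-trans (length-map suc (elements p)) (length-elements p)

private
  all₁ = to (T-∧ {∀ᵗ 1 (λ t → dichotomous (arc t))}) (from T-≡ small-dichotomous)
  all₂ = to (T-∧ {∀ᵗ 2 (λ t → dichotomous (arc t))}) (proj₂ all₁)
  all₃ = to (T-∧ {∀ᵗ 3 (λ t → dichotomous (arc t))}) (proj₂ all₂)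

dichotomous-sound : ∀ m → suc m ≤ 4 → ∀ (t : Arcs (suc m)) → T (dichotomous (arc t))
dichotomous-sound zero _ = ∀ᵗ-sound {1} _ (proj₁ all₁)
dichotomous-sound (suc zero) _ = ∀ᵗ-sound {2} _ (proj₁ all₂)
dichotomous-sound (suc (suc zero)) _ = ∀ᵗ-sound {3} _ (proj₁ all₃)
dichotomous-sound (suc (suc (suc zero))) _ = ∀ᵗ-sound {4} _ (proj₂ all₃)
dichotomous-sound (suc (suc (suc (suc _)))) (s≤s (s≤s (s≤s (s≤s ()))))
dichotomous-cases : ∀ (_≻_ : Relᵇ m) → T (dichotomous _≻_) → (∃ λ a → ∀ z → ¬ T (z ≻ a)) ⊎
                    ∃[ a ] ∃[ b ] ∃[ c ] T (a ≻ b) × CycleIn _≻_ (allFin m) a b c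
dichotomous-cases {m} _≻_ t = case to (T-∨ {any (isTop _≻_ V) V}) t of λ where
    (inj₁ t) → case any-witness (isTop _≻_ V) V t of λ where
      (a , _ , top) → inj₁ (a , λ z → T-not⁻ (all-lookup (λ z → not (z ≻ a)) top (∈-allFin z)))
    (inj₂ t) → case any-witness _ V t of λ where
      (a , _ , t) → case any-witness _ V t of λ where
        (b , _ , t) → case to (T-∧ {a ≻ b}) t of λ where
          (a≻b , t) → case any-witness (isCycle _≻_ V a b) V t of λ where
            (c , _ , t) → inj₂ (a , b , c , a≻b , isCycle-sound _≻_ V t)
  where V = allFin m

allBalanced₅-sound : ∀ Ls → allBalanced₅ Ls ≡ true → ∀ t → T (balanced Ls (arc t))
allBalanced₅-sound Ls eq = ∀ᵗ-sound {5} (λ t → balanced Ls (arc t)) (from T-≡ eq)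

allBalanced₇-sound : ∀ Ls → allBalanced₇ Ls ≡ true → ∀ o₁≻x o₁ o₂≻o₁ o₂ o₃≻o₁ o₃ →
                     T (admissible o₁≻x o₁ o₂≻o₁) →
                     T (balanced Ls (arc (anchored o₁≻x o₁ o₂≻o₁ o₂ o₃≻o₁ o₃)))
allBalanced₇-sound Ls eq o₁≻x o₁ o₂≻o₁ o₂ o₃≻o₁ o₃ ad =
  ∀ᵛ-sound (λ o₃ → P o₁≻x o₁ o₂≻o₁ o₂ o₃≻o₁ o₃) (∀ᵇ-sound (λ o₃≻o₁ → ∀ᵛ 3 λ o₃ → P o₁≻x o₁ o₂≻o₁ o₂ o₃≻o₁ o₃)
    (∀ᵛ-sound (λ o₂ → ∀ᵇ λ o₃≻o₁ → ∀ᵛ 3 λ o₃ → P o₁≻x o₁ o₂≻o₁ o₂ o₃≻o₁ o₃)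
      (T-implies⁻ (∀ᵇ-sound (Q o₁≻x o₁) (∀ᵛ-sound (λ o₁ → ∀ᵇ (Q o₁≻x o₁))
        (∀ᵇ-sound (λ o₁≻x → ∀ᵛ 3 λ o₁ → ∀ᵇ (Q o₁≻x o₁)) (from T-≡ eq) o₁≻x) o₁) o₂≻o₁) ad) o₂) o₃≻o₁) o₃
  where
  P : Bool → Vec Bool 3 → Bool → Vec Bool 3 → Bool → Vec Bool 3 → Bool
  P o₁≻x o₁ o₂≻o₁ o₂ o₃≻o₁ o₃ = balanced Ls (arc (anchored o₁≻x o₁ o₂≻o₁ o₂ o₃≻o₁ o₃))
  Q : Bool → Vec Bool 3 → Bool → Bool
  Q o₁≻x o₁ o₂≻o₁ = not (admissible o₁≻x o₁ o₂≻o₁) ∨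
    (∀ᵛ 3 λ o₂ → ∀ᵇ λ o₃≻o₁ → ∀ᵛ 3 λ o₃ → P o₁≻x o₁ o₂≻o₁ o₂ o₃≻o₁ o₃)

module Listings {n : ℕ} (Tn : Tournament n) where
  open Equilibrium Tn
  open Charts Tn

  arcsOf : (vs : List (Fin n)) → Arcs (length vs)
  arcsOf []       = tt
  arcsOf (v ∷ vs) = Vec.tabulate (λ j → beats Tn v (lookup vs j)) , arcsOf vs

  arc-arcsOf : ∀ {vs} → Unique vs → ∀ i j → arc (arcsOf vs) i j ≡ beats Tn (lookup vs i) (lookup vs j)
  arc-arcsOf {v ∷ vs} (v∉vs ∷ u) zero    zero    = sym (¬T⇒false ≻-irrefl)
  arc-arcsOf {v ∷ vs} (v∉vs ∷ u) zero    (suc j) = Vec.lookup∘tabulate _ j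
  arc-arcsOf {v ∷ vs} (v∉vs ∷ u) (suc i) zero    =
    ≡-trans (cong not (Vec.lookup∘tabulate _ i)) (flip (All.lookup v∉vs (∈-lookup i)))
    where
    flip : ∀ {w} → v ≢ w → not (beats Tn v w) ≡ beats Tn w v
    flip {w} v≢w with beats Tn v w in eq
    ... | true  = sym (¬T⇒false (≻-asym (from T-≡ eq)))
    ... | false = sym (to T-≡ (≻-connex v≢w (subst T eq)))
  arc-arcsOf {v ∷ vs} (v∉vs ∷ u) (suc i) (suc j) = arc-arcsOf u i j

  record Listing (P : Fin n → Set) (vs : List (Fin n)) : Set where
    constructor listing
    field
      unique   : Unique vs
      sound    : ∀ {v} → v ∈ˡ vs → P v
      complete : ∀ {v} → P v → v ∈ˡ vs

  open Listing public

  Listing-resp-↭ : ∀ {P vs ws} → vs ↭ ws → Listing P vs → Listing P ws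
  Listing-resp-↭ π (listing u s c) =
    listing (Unique-resp-↭ π u) (s ∘ Perm.∈-resp-↭ (↭-sym π)) (Perm.∈-resp-↭ π ∘ c)

  chart : ∀ {R B vs} → Listing (λ v → v ∈ B × v ∈ R) vs →
          (∀ {v} → v ∈ˡ vs → ∃ λ k → Guided R k (inN Tn B v)) →
          Chart R B (arc (arcsOf vs)) (lookup vs)
  chart ls g = record
    { arcs   = arc-arcsOf (unique ls)
    ; range  = λ i → sound ls (∈-lookup i)
    ; covers = λ v∈B v∈R → let v∈vs = complete ls (v∈B , v∈R) in index v∈vs , sym (lookup-index v∈vs)
    ; nbhds  = λ i → g (∈-lookup i)
    }

  Top : List (Fin n) → Fin n → Set
  Top S a = a ∈ˡ S × (∀ {z} → z ∈ˡ S → ¬ z ≻ a)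

  module _ {v : Fin n} {vs : List (Fin n)} (u : Unique (v ∷ vs)) where
    private
      S = v ∷ vs
      V = allFin (length S)
      r = lookup S
      _▷_ = arc (arcsOf S)

      ▷⁻ : ∀ i j → T (i ▷ j) → r i ≻ r j
      ▷⁻ i j = subst T (arc-arcsOf u i j)

      ▷⁺ : ∀ {z} (z∈S : z ∈ˡ S) j → z ≻ r j → T (index z∈S ▷ j)
      ▷⁺ z∈S j z≻j = subst T (sym (arc-arcsOf u (index z∈S) j)) (subst (_≻ r j) (lookup-index z∈S) z≻j)

      ¬both : ∀ {p q} → (∀ {j} → j ∈ˡ V → T (j ▷ p) → ¬ T (j ▷ q)) → ∀ {z} → z ∈ˡ S → z ≻ r p → ¬ z ≻ r q
      ¬both {p} {q} f z∈S z≻p z≻q = f (∈-allFin (index z∈S)) (▷⁺ z∈S p z≻p) (▷⁺ z∈S q z≻q)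

    dichotomy : length S ≤ 4 → ∃ (Top S) ⊎
      ∃[ a ] ∃[ b ] ∃[ c ] (a ∈ˡ S × b ∈ˡ S × c ∈ˡ S) × Cycle (_∈ˡ S) a b c
    dichotomy len = case dichotomous-cases _▷_ (dichotomous-sound _ len (arcsOf S)) of λ where
      (inj₁ (a , top)) → inj₁ (r a , ∈-lookup a , λ {z} z∈S z≻a → top (index z∈S) (▷⁺ z∈S a z≻a))
      (inj₂ (a , b , c , a▷b , cyc)) → inj₂ (r a , r b , r c , (∈-lookup a , ∈-lookup b , ∈-lookup c) , record
        { a≻b = ▷⁻ a b a▷b ; b≻c = ▷⁻ b c (CycleIn.b≻c cyc) ; c≻a = ▷⁻ c a (CycleIn.c≻a cyc)
        ; ab = ¬both {b} {a} (CycleIn.ab cyc) ; bc = ¬both {c} {b} (CycleIn.bc cyc)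
        ; ca = ¬both {a} {c} (CycleIn.ca cyc) })

-- Balanced multisets for sets of seven vertices

admissible⁺ : ∀ o₁≻x {a b c o₂≻o₁} → (¬ T o₁≻x → ¬ T o₂≻o₁) →
  (T o₁≻x → ¬ (T b × T a) × ¬ (T c × T b) × ¬ (T a × T c)) →
  T (admissible o₁≻x (a ∷ b ∷ c ∷ []) o₂≻o₁)
admissible⁺ false h _ = T-not⁺ (h λ ())
admissible⁺ true _ h with ba , cb , ac ← h _ =
  from T-∧ (T-not⁺ (ba ∘ to T-∧) , from T-∧ (T-not⁺ (cb ∘ to T-∧) , T-not⁺ (ac ∘ to T-∧)))

either-all : ∀ {W : Set} {P : X → Set} xs → (∀ {x} → x ∈ˡ xs → W ⊎ P x) → W ⊎ All P xs
either-all [] h = inj₂ []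
either-all (x ∷ xs) h with h (here refl)
... | inj₁ w = inj₁ w
... | inj₂ p with either-all xs (h ∘ there)
...   | inj₁ w  = inj₁ w
...   | inj₂ ps = inj₂ (p ∷ ps)

-- Seven is odd, so the weak bound is strict.
c+c≤7⇒2c<7 : ∀ c → c + c ≤ 7 → 2 * c < 7
c+c≤7⇒2c<7 c c+c≤7 with c ≤? 3
... | yes c≤3 = s≤s (*-monoʳ-≤ 2 c≤3)
... | no c≰3  = contradiction (≤-trans (+-mono-≤ (≰⇒> c≰3) (≰⇒> c≰3)) c+c≤7) (<⇒≱ ≤-refl)

-- Comparisons between two multisets

module Counting {n : ℕ} (Tn : Tournament n) where
  open Equilibrium Tn
  open Charts Tn

  private variable
    x y : Fin n
    L M : List (Fin n)

  count-all : All (y ≻_) L → count y L ≡ length L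
  count-all = cong length ∘ filter-all (T? ∘ beats Tn _)

  count-none : All (λ x → ¬ y ≻ x) L → count y L ≡ 0
  count-none = cong length ∘ filter-none (T? ∘ beats Tn _)

  count-∷⁺ : y ≻ x → count y (x ∷ L) ≡ suc (count y L)
  count-∷⁺ = cong length ∘ filter-accept (T? ∘ beats Tn _)

  count-∷⁻ : ¬ y ≻ x → count y (x ∷ L) ≡ count y L
  count-∷⁻ = cong length ∘ filter-reject (T? ∘ beats Tn _)

  count-++ : ∀ y L M → count y (L ++ M) ≡ count y L + count y M
  count-++ y L M = ≡-trans (cong length (filter-++ (T? ∘ beats Tn y) L M)) (length-++ (filterᵇ (beats Tn y) L))

  count≤length : ∀ y L → count y L ≤ length L
  count≤length y = length-filter (T? ∘ beats Tn y)

  private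
    left-comm = x∙yz≈y∙xz +-commutativeSemigroup

  -- The number of comparisons, with multiplicity, that `M` wins against `L`.
  total : List (Fin n) → List (Fin n) → ℕ
  total L M = sum (map (λ y → count y L) M)

  total-[] : ∀ M → total [] M ≡ 0
  total-[] []      = refl
  total-[] (_ ∷ M) = total-[] M

  -- Each entry of `M` differs from `x`, hence exactly one of the two beats the other.
  total-∷ : ∀ x L M → All (x ≢_) M → total (x ∷ L) M + count x M ≡ length M + total L M
  total-∷ x L [] _ = refl
  total-∷ x L (y ∷ M) (x≢y ∷ x∉M) with T? (beats Tn x y)
  ... | yes x≻y rewrite count-∷⁻ {L = L} (≻-asym x≻y) | count-∷⁺ {L = M} x≻y = begin
    count y L + total (x ∷ L) M + suc (count x M)   ≡⟨ +-suc _ _ ⟩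
    suc (count y L + total (x ∷ L) M + count x M)   ≡⟨ cong suc (+-assoc (count y L) _ _) ⟩
    suc (count y L + (total (x ∷ L) M + count x M)) ≡⟨ cong (λ k → suc (count y L + k)) (total-∷ x L M x∉M) ⟩
    suc (count y L + (length M + total L M))        ≡⟨ cong suc (left-comm (count y L) (length M) (total L M)) ⟩
    suc (length M + (count y L + total L M))        ∎
    where open ≡-Reasoning
  ... | no x⊁y rewrite count-∷⁺ {L = L} (≻-connex x≢y x⊁y) | count-∷⁻ {L = M} x⊁y = begin
    suc (count y L + total (x ∷ L) M + count x M)   ≡⟨ cong suc (+-assoc (count y L) _ _) ⟩
    suc (count y L + (total (x ∷ L) M + count x M)) ≡⟨ cong (λ k → suc (count y L + k)) (total-∷ x L M x∉M) ⟩
    suc (count y L + (length M + total L M))        ≡⟨ cong suc (left-comm (count y L) (length M) (total L M)) ⟩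
    suc (length M + (count y L + total L M))        ∎
    where open ≡-Reasoning

  total+total : ∀ L M → All (λ x → All (x ≢_) M) L → total L M + total M L ≡ length L * length M
  total+total [] M _ = ≡-trans (+-identityʳ _) (total-[] M)
  total+total (x ∷ L) M (x∉M ∷ L∩M) = begin
    total (x ∷ L) M + (count x M + total M L) ≡⟨ +-assoc (total (x ∷ L) M) _ _ ⟨
    total (x ∷ L) M + count x M + total M L   ≡⟨ cong (_+ total M L) (total-∷ x L M x∉M) ⟩
    length M + total L M + total M L          ≡⟨ +-assoc (length M) _ _ ⟩
    length M + (total L M + total M L)        ≡⟨ cong (length M +_) (total+total L M L∩M) ⟩
    length M + length L * length M            ∎
    where open ≡-Reasoning

  -- The summand `length M` collects the slack of one from each strict inequality.
  total-halved : ∀ L M → All (λ y → 2 * count y L < length L) M → 2 * total L M + length M ≤ length M * length L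
  total-halved L [] _ = z≤n
  total-halved L (y ∷ M) (h ∷ hs) = begin
    2 * (count y L + total L M) + suc (length M)     ≡⟨ cong (_+ suc (length M)) (*-distribˡ-+ 2 (count y L) _) ⟩
    2 * count y L + 2 * total L M + suc (length M)   ≡⟨ +-suc _ (length M) ⟩
    suc (2 * count y L + 2 * total L M + length M)   ≡⟨ cong suc (+-assoc (2 * count y L) _ _) ⟩
    suc (2 * count y L) + (2 * total L M + length M) ≤⟨ +-mono-≤ h (total-halved L M hs) ⟩
    length L + length M * length L                   ∎
    where open ≤-Reasoning

  -- Each of the `ℓ * k` comparisons has one winner, so adding the two bounds of `total-halved`
  -- leaves `k + ℓ ≤ 0`. Two empty multisets satisfy the hypotheses, whence the form of the
  -- conclusion.
  balanced-disjoint-⊥ : ∀ L M → All (λ x → All (x ≢_) M) L →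
    All (λ y → 2 * count y L < length L) M → All (λ x → 2 * count x M < length M) L → length L ≡ 0
  balanced-disjoint-⊥ L M L∩M hM hL = n≤0⇒n≡0 (≤-trans (m≤n+m ℓ k) (+-cancelˡ-≤ (2 * (ℓ * k)) _ _ (begin
    2 * (ℓ * k) + (k + ℓ)                             ≡⟨ cong (λ t → 2 * t + (k + ℓ)) (total+total L M L∩M) ⟨
    2 * (total L M + total M L) + (k + ℓ)             ≡⟨ cong (_+ (k + ℓ)) (*-distribˡ-+ 2 (total L M) _) ⟩
    2 * total L M + 2 * total M L + (k + ℓ)           ≡⟨ interchange +-commutativeSemigroup (2 * total L M) (2 * total M L) k ℓ ⟩
    (2 * total L M + k) + (2 * total M L + ℓ)         ≤⟨ +-mono-≤ (total-halved L M hM) (total-halved M L hL) ⟩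
    k * ℓ + ℓ * k                                     ≡⟨ cong (_+ ℓ * k) (*-comm k ℓ) ⟩
    ℓ * k + ℓ * k                                     ≡⟨ cong (ℓ * k +_) (+-identityʳ (ℓ * k)) ⟨
    2 * (ℓ * k)                                       ≡⟨ +-identityʳ _ ⟨
    2 * (ℓ * k) + 0                                   ∎)))
    where
    open ≤-Reasoning
    ℓ = length L
    k = length M

Unique-++⁻ˡ : ∀ {xs ys : List X} → Unique (xs ++ ys) → Unique xs
Unique-++⁻ˡ {xs = []}     _         = []
Unique-++⁻ˡ {xs = _ ∷ xs} (x∉ ∷ us) = All.++⁻ˡ xs x∉ ∷ Unique-++⁻ˡ us

-- Case analysis for a minimal retentive set of seven vertices

module Heptad {n : ℕ} (Tn : Tournament n) (R : Subset n)
              (min : MinimalRetentive Tn R) (∣R∣≡7 : ∣ R ∣ ≡ 7) where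
  open Equilibrium Tn
  open Charts Tn
  open Listings Tn
  open Counting Tn

  Weighted : Set
  Weighted = ∃ (Balanced R full)

  N : Fin n → Subset n
  N = inN Tn full

  nbhd : ∀ {x} → x ∈ R → Guided R n (N x)
  nbhd = retentive⇒guided (proj₁ min) (m≤n⇒m≤1+n (≤-reflexive (∣⊤∣≡n n)))

  ∈N : ∀ {x y} → y ≻ x → y ∈ N x
  ∈N = ∈inN⁺ ∈⊤

  N⁻ : ∀ {x y} → y ∈ N x → y ≻ x
  N⁻ = proj₂ ∘ ∈inN⁻

  singleton-weighted : ∀ {x} → x ∈ R → (∀ {y} → y ∉ R → ¬ y ≻ x) → Weighted
  singleton-weighted x∈R unbeaten = _ , record
    { inside = (∈⊤ , x∈R) ∷ []
    ; halved = λ _ y∉R → subst (λ k → 2 * k < 1) (sym (count-none (unbeaten y∉R ∷ []))) (s≤s z≤n) }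

  -- Otherwise R - v would be retentive.
  supported : ∀ {v} → v ∈ R → ∃ λ u → u ∈ R × τ' Tn n (N u) v
  supported {v} v∈R with Fin.any? (λ u → (u ∈? R) ×-dec τ′? n (N u) v)
  ... | yes s = s
  ... | no ∄u = contradiction ret (proj₂ min (R - v) (x∈p⇒p-x⊂p v∈R))
    where
    nonempty : Nonempty (R - v)
    nonempty with nonempty? (R - v)
    ... | yes ne = ne
    ... | no empty = contradiction
      (≤-trans (≤-reflexive (sym ∣R∣≡7)) (≤-trans (p⊆q⇒∣p∣≤∣q∣ R⊆⁅v⁆) (≤-reflexive (∣⁅x⁆∣≡1 v)))) λ { (s≤s ()) }
      where
      R⊆⁅v⁆ : R ⊆ ⁅ v ⁆
      R⊆⁅v⁆ {u} u∈R with u Fin.≟ v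
      ... | yes refl = x∈⁅x⁆ v
      ... | no u≢v = contradiction (u , x∈p∧x≢y⇒x∈p-y u∈R u≢v) empty
    ret : Retentive' Tn n full (R - v)
    ret = (λ _ → ∈⊤) , nonempty , λ u u∈R-v _ y t → let u∈R = p─q⊆p R ⁅ v ⁆ u∈R-v in
      x∈p∧x≢y⇒x∈p-y (τ⊆R (nbhd u∈R) t) λ { refl → ∄u (u , u∈R , t) }

  fullChart : ∀ {vs} → Listing (_∈ R) vs → Chart R full (arc (arcsOf vs)) (lookup vs)
  fullChart ls = chart (listing (unique ls) (λ v∈ → ∈⊤ , sound ls v∈) (complete ls ∘ proj₂))
                       (λ v∈ → n , nbhd (sound ls v∈))

  module _ {P : Fin n → Set} {o₁ o₂ o₃ x a b c : Fin n}
           (a≻x : a ≻ x) (b≻x : b ≻ x) (c≻x : c ≻ x) (C : Cycle P a b c)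
           (x≻o₂ : x ≻ o₂) (x≻o₃ : x ≻ o₃) (o₂≻o₃ : o₂ ≻ o₃)
           (¬o₁≻x⇒o₁≻o₂ : ¬ o₁ ≻ x → o₁ ≻ o₂) (o₁≻x⇒P : o₁ ≻ x → P o₁) where
    open Cycle C

    private
      zs : List (Fin n)
      zs = o₃ ∷ o₂ ∷ o₁ ∷ x ∷ a ∷ b ∷ c ∷ []
      row : Fin n → Vec Bool 3
      row o = beats Tn o a ∷ beats Tn o b ∷ beats Tn o c ∷ []

    arcsOf-anchored : arcsOf zs ≡
      anchored (beats Tn o₁ x) (row o₁) (beats Tn o₂ o₁) (row o₂) (beats Tn o₃ o₁) (row o₃)
    arcsOf-anchored
      rewrite ¬T⇒false (≻-asym o₂≻o₃) | ¬T⇒false (≻-asym x≻o₂) | ¬T⇒false (≻-asym x≻o₃)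
            | ¬T⇒false (≻-asym a≻x) | ¬T⇒false (≻-asym b≻x) | ¬T⇒false (≻-asym c≻x)
            | to T-≡ a≻b | ¬T⇒false (≻-asym c≻a) | to T-≡ b≻c = refl

    anchored-balanced : ∀ Ls → allBalanced₇ Ls ≡ true → T (balanced Ls (arc (arcsOf zs)))
    anchored-balanced Ls ok = subst (λ t → T (balanced Ls (arc t))) (sym arcsOf-anchored)
      (allBalanced₇-sound Ls ok (beats Tn o₁ x) (row o₁) (beats Tn o₂ o₁) (row o₂) (beats Tn o₃ o₁) (row o₃)
        (admissible⁺ (beats Tn o₁ x)
        (≻-asym ∘ ¬o₁≻x⇒o₁≻o₂)
        (λ o₁≻x → (λ (p , q) → ab (o₁≻x⇒P o₁≻x) p q) , (λ (p , q) → bc (o₁≻x⇒P o₁≻x) p q) ,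
                  (λ (p , q) → ca (o₁≻x⇒P o₁≻x) p q))))

    anchored-weighted : Listing (_∈ R) zs → Weighted
    anchored-weighted ls = balanced-sound (fullChart ls) (map multiset weights₇)
      (anchored-balanced (map multiset weights₇) balanced₇)

  chain₂ : ∀ u v → u ≢ v → ∃₂ λ o₁ o₂ → (u ∷ v ∷ []) ↭ (o₂ ∷ o₁ ∷ []) × o₁ ≻ o₂
  chain₂ u v u≢v with complete Tn u v u≢v
  ... | inj₁ u≻v = u , v , swap u v refl , u≻v
  ... | inj₂ v≻u = v , u , refl , v≻u

  -- Insertion of `u` into the chain `p ≻ q`: before the first member that it beats, or else at the
  -- end.
  chain₃ : ∀ u v w → Unique (u ∷ v ∷ w ∷ []) → ∃[ o₁ ] ∃[ o₂ ] ∃[ o₃ ]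
           (u ∷ v ∷ w ∷ []) ↭ (o₃ ∷ o₂ ∷ o₁ ∷ []) × o₁ ≻ o₂ × o₂ ≻ o₃
  chain₃ u v w ((u≢v ∷ u≢w ∷ []) ∷ (v≢w ∷ []) ∷ _) with chain₂ v w v≢w
  ... | p , q , π , p≻q with All.lookup (u≢v ∷ u≢w ∷ []) (Perm.∈-resp-↭ (↭-sym π) (there (here refl)))
                           | All.lookup (u≢v ∷ u≢w ∷ []) (Perm.∈-resp-↭ (↭-sym π) (here refl))
  ...   | u≢p | u≢q with complete Tn u p u≢p
  ...     | inj₁ u≻p = u , p , q , trans (prep u π) (trans (swap u q refl) (prep q (swap u p refl))) , u≻p , p≻q
  ...     | inj₂ p≻u with complete Tn u q u≢q
  ...       | inj₁ u≻q = p , u , q , trans (prep u π) (swap u q refl) , p≻u , u≻q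
  ...       | inj₂ q≻u = p , q , u , prep u π , p≻q , q≻u

  module _ {x : Fin n} where

    -- The lengths leave two cases: three out-neighbours of `x`, arranged in a chain, or two of them
    -- and a fourth in-neighbour, which takes the role of `o₁`.
    cyclic-weighted : ∀ {a b c P} rest outs → length (a ∷ b ∷ c ∷ rest ++ outs) ≡ 6 → 2 ≤ length outs →
      Listing (_∈ R) (x ∷ a ∷ b ∷ c ∷ rest ++ outs) →
      All (_≻ x) (a ∷ b ∷ c ∷ rest) → All (x ≻_) outs → Cycle P a b c → All P rest → Weighted
    cyclic-weighted {a} {b} {c} [] (u ∷ v ∷ w ∷ []) _ _ ls (a≻x ∷ b≻x ∷ c≻x ∷ []) x≻outs C _
      with _ ∷ _ ∷ _ ∷ _ ∷ u-outs ← unique ls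
      with o₁ , o₂ , o₃ , π , o₁≻o₂ , o₂≻o₃ ← chain₃ u v w u-outs
      with x≻o₃ ∷ x≻o₂ ∷ x≻o₁ ∷ [] ← Perm.All-resp-↭ π x≻outs =
      anchored-weighted a≻x b≻x c≻x C x≻o₂ x≻o₃ o₂≻o₃ (λ _ → o₁≻o₂)
        (λ o₁≻x → contradiction o₁≻x (≻-asym x≻o₁))
        (Listing-resp-↭ (trans (Perm.++-comm (x ∷ a ∷ b ∷ c ∷ []) _) (Perm.++⁺ʳ _ π)) ls)
    cyclic-weighted {a} {b} {c} (z ∷ []) (u ∷ v ∷ []) _ _ ls (a≻x ∷ b≻x ∷ c≻x ∷ z≻x ∷ []) x≻outs C (Pz ∷ [])
      with _ ∷ _ ∷ _ ∷ _ ∷ _ ∷ (u≢v ∷ []) ∷ _ ← unique ls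
      with o₂ , o₃ , π , o₂≻o₃ ← chain₂ u v u≢v
      with x≻o₃ ∷ x≻o₂ ∷ [] ← Perm.All-resp-↭ π x≻outs =
      anchored-weighted a≻x b≻x c≻x C x≻o₂ x≻o₃ o₂≻o₃ (λ z⊁x → contradiction z≻x z⊁x) (λ _ → Pz)
        (Listing-resp-↭ (trans (Perm.++-comm (x ∷ a ∷ b ∷ c ∷ []) _)
          (Perm.++⁺ʳ _ (trans (prep z π) (trans (swap z o₃ refl) (prep o₃ (swap z o₂ refl)))))) ls)
    cyclic-weighted [] (_ ∷ []) _ (s≤s ()) 
    cyclic-weighted [] (_ ∷ _ ∷ []) ()
    cyclic-weighted [] (_ ∷ _ ∷ _ ∷ _ ∷ _) ()
    cyclic-weighted (_ ∷ []) (_ ∷ []) _ (s≤s ())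
    cyclic-weighted (_ ∷ []) (_ ∷ _ ∷ _ ∷ _) ()
    cyclic-weighted (_ ∷ _ ∷ []) (_ ∷ []) _ (s≤s ())
    cyclic-weighted (_ ∷ _ ∷ []) (_ ∷ _ ∷ _) ()
    cyclic-weighted (_ ∷ _ ∷ _ ∷ []) [] _ ()
    cyclic-weighted (_ ∷ _ ∷ _ ∷ []) (_ ∷ _) ()
    cyclic-weighted (_ ∷ _ ∷ _ ∷ _ ∷ _) _ ()

  quintet-weighted : ∀ {B} Q → length Q ≡ 5 → Listing (λ v → v ∈ B × v ∈ R) Q →
    (∀ {v} → v ∈ˡ Q → ∃ λ k → Guided R k (inN Tn B v)) → ∃ (Balanced R B)
  quintet-weighted Q@(_ ∷ _ ∷ _ ∷ _ ∷ _ ∷ []) refl ls g =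
    balanced-sound (chart ls g) (map multiset weights₅)
      (allBalanced₅-sound (map multiset weights₅) balanced₅ (arcsOf Q))

  -- R is here a 3-cycle x ≻ u ≻ Q ≻ x blown up at Q; x, u and Q receive equal total weight.
  module _ {x u : Fin n} {Q : List (Fin n)} (ls : Listing (_∈ R) (x ∷ Q ++ u ∷ [])) (∣Q∣≡5 : length Q ≡ 5)
           (Q≻x : All (_≻ x) Q) (x≻u : x ≻ u) where

    private
      x∈R : x ∈ R
      x∈R = sound ls (here refl)

      u∈R : u ∈ R
      u∈R = sound ls (there (∈-++⁺ʳ Q (here refl)))

      Q⊆R : ∀ {q} → q ∈ˡ Q → q ∈ R
      Q⊆R q∈Q = sound ls (there (∈-++⁺ˡ q∈Q))

      q≻x : ∀ {q} → q ∈ˡ Q → q ≻ x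
      q≻x = All.lookup Q≻x

      cases : ∀ {v} → v ∈ R → v ≡ x ⊎ v ∈ˡ Q ⊎ v ≡ u
      cases v∈R with complete ls v∈R
      ... | here v≡x = inj₁ v≡x
      ... | there v∈ with ∈-++⁻ Q v∈
      ...   | inj₁ v∈Q        = inj₂ (inj₁ v∈Q)
      ...   | inj₂ (here v≡u) = inj₂ (inj₂ v≡u)

      -- The only vertex of `R` that `x` beats is `u`, so `x` is supported by `u`; in `N u` it beats
      -- no vertex of `R`, and `harmless-unbeaten` applies.
      x-unbeaten : ∀ {z} → z ≻ u → ¬ z ≻ x
      x-unbeaten z≻u with w , w∈R , t ← supported x∈R with cases w∈R
      ... | inj₁ refl = contradiction (N⁻ (τ′⊆ {n} t)) ≻-irrefl
      ... | inj₂ (inj₁ w∈Q) = contradiction (N⁻ (τ′⊆ {n} t)) (≻-asym (q≻x w∈Q))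
      ... | inj₂ (inj₂ refl) = harmless-unbeaten (nbhd u∈R) t harmless (∈N z≻u)
        where
        harmless : ∀ {v} → v ∈ N u → v ∈ R → ¬ x ≻ v
        harmless v∈N v∈R with cases v∈R
        ... | inj₁ refl        = ≻-irrefl
        ... | inj₂ (inj₁ v∈Q)  = ≻-asym (q≻x v∈Q)
        ... | inj₂ (inj₂ refl) = contradiction (N⁻ v∈N) ≻-irrefl

      u≻q : ∀ {q} → q ∈ˡ Q → u ≻ q
      u≻q q∈Q = ≻-connex (λ { refl → ≻-asym x≻u (q≻x q∈Q) }) (λ q≻u → x-unbeaten q≻u (q≻x q∈Q))

      u-top : ∀ {q} → q ∈ˡ Q → ∀ {z} → z ∈ N q → z ∈ R → ¬ z ≻ u
      u-top q∈Q z∈N z∈R with cases z∈R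
      ... | inj₁ refl        = contradiction (N⁻ z∈N) (≻-asym (q≻x q∈Q))
      ... | inj₂ (inj₁ z∈Q)  = ≻-asym (u≻q z∈Q)
      ... | inj₂ (inj₂ refl) = ≻-irrefl

      u-unbeaten : ∀ {q y} → q ∈ˡ Q → y ≻ u → ¬ y ≻ q
      u-unbeaten q∈Q y≻u y≻q = proj₂ (top-unbeaten (nbhd (Q⊆R q∈Q)) (∈N (u≻q q∈Q)) (u-top q∈Q)) (∈N y≻q) y≻u

      -- Only `x` can support `q`: for `w` in `Q`, τ of `N w` contains nothing but `u`, and `u`
      -- beats `q`.
      Q⊆τ : ∀ {q} → q ∈ˡ Q → τ' Tn n (N x) q
      Q⊆τ q∈Q with w , w∈R , t ← supported (Q⊆R q∈Q) with cases w∈R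
      ... | inj₁ refl        = t
      ... | inj₂ (inj₁ w∈Q)  = contradiction
        (top-unique (nbhd w∈R) (∈N (u≻q w∈Q)) (u-top w∈Q) t) (λ { refl → ≻-irrefl (u≻q q∈Q) })
      ... | inj₂ (inj₂ refl) = contradiction (N⁻ (τ′⊆ {n} t)) (≻-asym (u≻q q∈Q))

      Q-complete : ∀ {v} → v ∈ N x → v ∈ R → v ∈ˡ Q
      Q-complete v∈N v∈R with cases v∈R
      ... | inj₁ refl        = contradiction (N⁻ v∈N) ≻-irrefl
      ... | inj₂ (inj₁ v∈Q)  = v∈Q
      ... | inj₂ (inj₂ refl) = contradiction (N⁻ v∈N) (≻-asym x≻u)

      Q-weighted : ∃ (Balanced R (N x))
      Q-weighted with _ ∷ us ← unique ls = quintet-weighted Q ∣Q∣≡5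
        (listing (Unique-++⁻ˡ us) (λ q∈Q → ∈N (q≻x q∈Q) , Q⊆R q∈Q) (λ (v∈N , v∈R) → Q-complete v∈N v∈R))
        -- In-neighbourhoods within `N x` are again guided by `R`, so `Q` can be treated inside
        -- `N x` as `R` is in the whole tournament.
        (τ⇒guided (nbhd x∈R) ∘ Q⊆τ)

    exceptional-weighted : Weighted
    exceptional-weighted with Q-weighted
    -- An empty balanced multiset is possible only if no vertex outside `R` beats `x`.
    ... | [] , bal = singleton-weighted x∈R λ y∉R y≻x → case halved bal (∈N y≻x) y∉R of λ ()
    ... | L@(_ ∷ _) , bal = replicate ℓ x ++ replicate ℓ u ++ L , record
      { inside = All.++⁺ (All.replicate⁺ ℓ (∈⊤ , x∈R)) (All.++⁺ (All.replicate⁺ ℓ (∈⊤ , u∈R))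
                   (All.map (λ (_ , v∈R) → ∈⊤ , v∈R) (inside bal)))
      ; halved = λ {y} _ y∉R → subst₂ (λ i j → 2 * i < j) (sym (count-parts y)) (sym length-parts) (bound y∉R)
      }
      where
      ℓ = length L
      count-parts : ∀ y → count y (replicate ℓ x ++ replicate ℓ u ++ L) ≡
                          count y (replicate ℓ x) + (count y (replicate ℓ u) + count y L)
      count-parts y = ≡-trans (count-++ y (replicate ℓ x) _)
        (cong (count y (replicate ℓ x) +_) (count-++ y (replicate ℓ u) L))
      length-parts : length (replicate ℓ x ++ replicate ℓ u ++ L) ≡ ℓ + (ℓ + ℓ)
      length-parts = ≡-trans (length-++ (replicate ℓ x)) (cong₂ _+_ (length-replicate ℓ)
        (≡-trans (length-++ (replicate ℓ u)) (cong (_+ ℓ) (length-replicate ℓ))))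
      all-of : ∀ {y v} → y ≻ v → count y (replicate ℓ v) ≡ ℓ
      all-of y≻v = ≡-trans (count-all (All.replicate⁺ ℓ y≻v)) (length-replicate ℓ)
      none-of : ∀ {y v} → ¬ y ≻ v → count y (replicate ℓ v) ≡ 0
      none-of y⊁v = count-none (All.replicate⁺ ℓ y⊁v)
      -- A vertex beating `u` beats neither `x` nor anything in `Q`; one beating `x` but not `u`
      -- gains `ℓ` and less than half of `L`; any other gains at most `ℓ`. As `ℓ` is positive, each
      -- gain is below half of the total `3ℓ`.
      bound : ∀ {y} → y ∉ R →
              2 * (count y (replicate ℓ x) + (count y (replicate ℓ u) + count y L)) < ℓ + (ℓ + ℓ)
      bound {y} y∉R with T? (beats Tn y u) | T? (beats Tn y x)
      ... | yes y≻u | _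
        rewrite none-of (x-unbeaten y≻u) | all-of y≻u
              | count-none {y = y} (All.map (λ (v∈N , v∈R) → u-unbeaten (Q-complete v∈N v∈R) y≻u) (inside bal)) =
        ≤-<-trans (*-monoʳ-≤ 2 (≤-reflexive (+-identityʳ ℓ))) (+-monoʳ-< ℓ (+-monoʳ-< ℓ (s≤s z≤n)))
      ... | no y⊁u | yes y≻x rewrite all-of y≻x | none-of y⊁u = begin-strict
        2 * (ℓ + count y L)     ≡⟨ *-distribˡ-+ 2 ℓ _ ⟩
        2 * ℓ + 2 * count y L   <⟨ +-monoʳ-< (2 * ℓ) (halved bal (∈N y≻x) y∉R) ⟩
        2 * ℓ + ℓ               ≡⟨ cong (λ k → ℓ + k + ℓ) (+-identityʳ ℓ) ⟩
        ℓ + ℓ + ℓ               ≡⟨ +-assoc ℓ ℓ ℓ ⟩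
        ℓ + (ℓ + ℓ)             ∎
        where open ≤-Reasoning
      ... | no y⊁u | no y⊁x rewrite none-of y⊁x | none-of y⊁u =
        ≤-<-trans (*-monoʳ-≤ 2 (count≤length y L)) (+-monoʳ-< ℓ (+-monoʳ-< ℓ (s≤s z≤n)))

  HasTop : Fin n → Set
  HasTop x = x ∈ R × ∃ λ a → a ≻ x × (∀ {z} → z ≻ x → z ∈ R → ¬ z ≻ a)

  tops : ∀ {xs} → All HasTop xs → List (Fin n)
  tops = All.reduce (proj₁ ∘ proj₂)

  -- By `top-unbeaten`, `y` does not beat both `x` and the top chosen for it, so each entry of `xs`
  -- contributes at most one.
  count-tops : ∀ y {xs} (ts : All HasTop xs) → count y xs + count y (tops ts) ≤ length xs
  count-tops y [] = z≤n
  count-tops y {x ∷ xs} ((x∈R , a , a≻x , top) ∷ ts) with T? (beats Tn y x)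
  ... | yes y≻x
    rewrite count-∷⁺ {L = xs} y≻x
          | count-∷⁻ {L = tops ts} (proj₂ (top-unbeaten (nbhd x∈R) (∈N a≻x) (top ∘ N⁻)) (∈N y≻x)) =
    s≤s (count-tops y ts)
  ... | no y⊁x rewrite count-∷⁻ {L = xs} y⊁x = ≤-trans (+-monoʳ-≤ (count y xs) (count-∷≤ a (tops ts)))
    (≤-trans (≤-reflexive (+-suc (count y xs) _)) (s≤s (count-tops y ts)))
    where
    count-∷≤ : ∀ a L → count y (a ∷ L) ≤ suc (count y L)
    count-∷≤ a L with T? (beats Tn y a)
    ... | yes y≻a = ≤-reflexive (count-∷⁺ y≻a)
    ... | no y⊁a  = m≤n⇒m≤1+n (≤-reflexive (count-∷⁻ y⊁a))

  -- τ of `N u` consists of the top of `u` alone. Together with `supported`, this puts every vertex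
  -- of `R` among the chosen tops.
  tops-exhaust : ∀ {xs} (ts : All HasTop xs) → ∀ {u v} → u ∈ˡ xs → τ' Tn n (N u) v → v ∈ˡ tops ts
  tops-exhaust ((x∈R , a , a≻x , top) ∷ ts) (here refl) t = here (top-unique (nbhd x∈R) (∈N a≻x) (top ∘ N⁻) t)
  tops-exhaust (_ ∷ ts) (there u∈xs) t = there (tops-exhaust ts u∈xs t)

  R-listing : Listing (_∈ R) (elements R)
  R-listing = listing (elements-unique R) (∈-elements⁻ R) ∈-elements⁺

  ∣elements∣≡7 : length (elements R) ≡ 7
  ∣elements∣≡7 = ≡-trans (length-elements R) ∣R∣≡7

  -- The chosen tops cover `R`, so `y` beats at least as many of them as vertices of `R`, while by
  -- `count-tops` the two counts add up to at most seven.
  topped-weighted : All HasTop (elements R) → Weighted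
  topped-weighted ts = elements R , record
    { inside = All.tabulate (λ x∈ → ∈⊤ , ∈-elements⁻ R x∈)
    ; halved = λ {y} _ _ → subst (2 * count y (elements R) <_) (sym ∣elements∣≡7)
        (c+c≤7⇒2c<7 (count y (elements R)) (begin
        count y (elements R) + count y (elements R) ≤⟨ +-monoʳ-≤ (count y (elements R)) (count-≤ y) ⟩
        count y (elements R) + count y (tops ts)    ≤⟨ count-tops y ts ⟩
        length (elements R)                         ≡⟨ ∣elements∣≡7 ⟩
        7                                           ∎))
    }
    where
    open ≤-Reasoning
    exhaust : ∀ {v} → v ∈ˡ elements R → v ∈ˡ tops ts
    exhaust v∈ with u , u∈R , t ← supported (∈-elements⁻ R v∈) = tops-exhaust ts (∈-elements⁺ u∈R) t
    count-≤ : ∀ y → count y (elements R) ≤ count y (tops ts)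
    count-≤ y = length-filter-mono (beats Tn y) (elements-unique R) exhaust

  module _ {x : Fin n} (x∈R : x ∈ R) where

    -- Distinguishes the out-degree of `x` in `R`: zero is impossible, one is the exceptional case,
    -- and from two on the in-degree is at most four, so that `dichotomy` decides.
    classify-split : ∀ ins outs → All (_≻ x) ins → All (λ z → ¬ z ≻ x) outs →
      Listing (_∈ R) (x ∷ ins ++ outs) → length (ins ++ outs) ≡ 6 → Weighted ⊎ HasTop x
    classify-split ins outs ins≻x outs⊁x ls len = go ins outs refl refl
      where
      x≻outs : All (x ≻_) outs
      x≻outs with x∉ ∷ _ ← unique ls = All.tabulate λ {z} z∈ →
        ≻-connex (λ z≡x → All.lookup x∉ (∈-++⁺ʳ ins z∈) (sym z≡x)) (All.lookup outs⊁x z∈)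

      ∈ins : ∀ {z} → z ≻ x → z ∈ R → z ∈ˡ ins
      ∈ins z≻x z∈R with complete ls z∈R
      ... | here refl = contradiction z≻x ≻-irrefl
      ... | there z∈ with ∈-++⁻ ins z∈
      ...   | inj₁ z∈ins  = z∈ins
      ...   | inj₂ z∈outs = contradiction z≻x (All.lookup outs⊁x z∈outs)

      ∈outs : ∀ {z} → x ≻ z → z ∈ R → z ∈ˡ outs
      ∈outs x≻z z∈R with complete ls z∈R
      ... | here refl = contradiction x≻z ≻-irrefl
      ... | there z∈ with ∈-++⁻ ins z∈
      ...   | inj₁ z∈ins  = contradiction x≻z (≻-asym (All.lookup ins≻x z∈ins))
      ...   | inj₂ z∈outs = z∈outs

      go : ∀ is os → is ≡ ins → os ≡ outs → Weighted ⊎ HasTop x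
      go [] _ refl _ = inj₁ (singleton-weighted x∈R λ _ y≻x →
        let _ , _ , w∈R , w∈N = guided-occupied (nbhd x∈R) (∈N y≻x) in case ∈ins (N⁻ w∈N) w∈R of λ ())
      -- A supporter of `x` is a vertex of `R` that `x` beats.
      go (_ ∷ _) [] refl refl with w , w∈R , t ← supported x∈R with () ← ∈outs (N⁻ (τ′⊆ {n} t)) w∈R
      go (_ ∷ _) (u ∷ []) refl refl with x≻u ∷ [] ← x≻outs = inj₁ (exceptional-weighted ls
        (suc-injective (≡-trans (≡-trans (+-comm 1 (length ins)) (sym (length-++ ins))) len)) ins≻x x≻u)
      go (_ ∷ _) (_ ∷ _ ∷ os) refl refl with dichotomy ins-unique ∣ins∣≤4
        where
        ins-unique : Unique ins
        ins-unique with _ ∷ us ← unique ls = Unique-++⁻ˡ us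
        ∣ins∣≤4 : length ins ≤ 4
        ∣ins∣≤4 = +-cancelʳ-≤ 2 (length ins) 4 (≤-trans (+-monoʳ-≤ (length ins) (m≤m+n 2 (length os)))
          (≤-reflexive (≡-trans (sym (length-++ ins)) len)))
      ... | inj₁ (a , a∈ins , top) =
        inj₂ (x∈R , a , All.lookup ins≻x a∈ins , λ z≻x z∈R → top (∈ins z≻x z∈R))
      ... | inj₂ (a , b , c , (a∈ , b∈ , c∈) , C)
        with is₁ , π₁ ← extract a∈
        with b∈₁ ← extract-≢ b∈ π₁ (≻⇒≢ (Cycle.a≻b C) ∘ sym)
           | c∈₁ ← extract-≢ c∈ π₁ (≻⇒≢ (Cycle.c≻a C))
        with is₂ , π₂ ← extract b∈₁
        with rest , π₃ ← extract (extract-≢ c∈₁ π₂ (≻⇒≢ (Cycle.b≻c C) ∘ sym)) =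
        inj₁ (cyclic-weighted rest outs
          (≡-trans (sym (Perm.↭-length (Perm.++⁺ʳ outs σ))) len) (s≤s (s≤s z≤n))
          (Listing-resp-↭ (prep x (Perm.++⁺ʳ outs σ)) ls)
          (Perm.All-resp-↭ σ ins≻x) x≻outs C
          (All.tabulate λ z∈ → Perm.∈-resp-↭ (↭-sym σ) (there (there (there z∈)))))
        where
        σ : ins ↭ a ∷ b ∷ c ∷ rest
        σ = trans π₁ (prep a (trans π₂ (prep b π₃)))

  classify : ∀ {x} → x ∈ˡ elements R → Weighted ⊎ HasTop x
  classify {x} x∈ with ys , π ← extract x∈
    with ins , outs , ρ , ins≻x , outs⊁x ← splitBy (λ z → beats Tn z x) ys =
    classify-split (∈-elements⁻ R x∈) ins outs ins≻x outs⊁x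
      (Listing-resp-↭ (trans π (prep x ρ)) R-listing)
      (suc-injective (≡-trans (sym (Perm.↭-length (trans π (prep x ρ)))) ∣elements∣≡7))

  weighted : Weighted
  weighted with either-all (elements R) classify
  ... | inj₁ w  = w
  ... | inj₂ ts = topped-weighted ts

-- Disjointness of minimal retentive sets and conclusion

minimal-⊈ : ∀ {n} (Tn : Tournament n) {R₁ R₂} → MinimalRetentive Tn R₁ → MinimalRetentive Tn R₂ → R₁ ≢ R₂ →
            ∃ λ x → x ∈ R₁ × x ∉ R₂
minimal-⊈ Tn {R₁} {R₂} (ret₁ , _) (_ , min₂) R₁≢R₂ with Fin.any? (λ x → (x ∈? R₁) ×-dec ¬? (x ∈? R₂))
... | yes x = x
... | no ∄x = contradiction ret₁ (min₂ R₁ (R₁⊆R₂ , proper))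
  where
  R₁⊆R₂ : R₁ ⊆ R₂
  R₁⊆R₂ {x} x∈R₁ = decidable-stable (x ∈? R₂) λ x∉R₂ → ∄x (x , x∈R₁ , x∉R₂)
  proper : ∃ λ x → x ∈ R₂ × x ∉ R₁
  proper with Fin.any? (λ x → (x ∈? R₂) ×-dec ¬? (x ∈? R₁))
  ... | yes x = x
  ... | no ∄y = contradiction (⊆-antisym R₁⊆R₂ λ {x} x∈R₂ →
    decidable-stable (x ∈? R₁) λ x∉R₁ → ∄y (x , x∈R₂ , x∉R₁)) R₁≢R₂

-- A nonempty intersection of retentive sets is retentive, and by `minimal-⊈` it is a proper subset
-- of `R₁`.
minimal-disjoint : ∀ {n} (Tn : Tournament n) {R₁ R₂} →
                   MinimalRetentive Tn R₁ → MinimalRetentive Tn R₂ → R₁ ≢ R₂ → ∀ {x} → x ∈ R₁ → x ∉ R₂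
minimal-disjoint Tn {R₁} {R₂} m₁@((_ , _ , ret₁) , min₁) m₂@((_ , _ , ret₂) , _) R₁≢R₂ {x} x∈R₁ x∈R₂
  with y , y∈R₁ , y∉R₂ ← minimal-⊈ Tn m₁ m₂ R₁≢R₂ =
  min₁ (R₁ ∩ R₂) (proj₁ ∘ x∈p∩q⁻ R₁ R₂ , y , y∈R₁ , y∉R₂ ∘ proj₂ ∘ x∈p∩q⁻ R₁ R₂)
    ( (λ _ → ∈⊤) , (x , x∈p∩q⁺ (x∈R₁ , x∈R₂))
    , λ v v∈ ne z t → let v∈R₁ , v∈R₂ = x∈p∩q⁻ R₁ R₂ v∈ in x∈p∩q⁺ (ret₁ v v∈R₁ ne z t , ret₂ v v∈R₂ ne z t) )

theorem7 : (n : ℕ) (Tn : Tournament n) (R₁ R₂ : Subset n) →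
    MinimalRetentive Tn R₁ → MinimalRetentive Tn R₂ → R₁ ≢ R₂ →
    ∣ R₁ ∣ ≡ 7 → ∣ R₂ ∣ ≡ 7 → ⊥
theorem7 n Tn R₁ R₂ m₁ m₂ R₁≢R₂ ∣R₁∣≡7 ∣R₂∣≡7
  with L , bal₁ ← Heptad.weighted Tn R₁ m₁ ∣R₁∣≡7
     | M , bal₂ ← Heptad.weighted Tn R₂ m₂ ∣R₂∣≡7
     | (_ , (y , y∈R₂) , _) , _ ← m₂ =
  L≢[] (Counting.balanced-disjoint-⊥ Tn L M
    (All.map (λ (_ , x∈R₁) →
      All.map (λ (_ , y∈R₂) → λ { refl → disjoint x∈R₁ y∈R₂ }) (inside bal₂)) (inside bal₁))
    (All.map (λ (_ , y∈R₂) → halved bal₁ ∈⊤ λ y∈R₁ → disjoint y∈R₁ y∈R₂) (inside bal₂))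
    (All.map (λ (_ , x∈R₁) → halved bal₂ ∈⊤ λ x∈R₂ → disjoint x∈R₁ x∈R₂) (inside bal₁)))
  where
  open Charts Tn
  disjoint : ∀ {x} → x ∈ R₁ → x ∉ R₂
  disjoint = minimal-disjoint Tn m₁ m₂ R₁≢R₂
  -- The vertex `y` of `R₂` lies outside `R₁`, so `halved` gives a strict inequality with `length L`
  -- on the larger side.
  L≢[] : length L ≢ 0
  L≢[] ∣L∣≡0 = n≮0 (subst (2 * count y L <_) ∣L∣≡0 (halved bal₁ ∈⊤ λ y∈R₁ → disjoint y∈R₁ y∈R₂))
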